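{- Let $w \in S_n$ be a fully commutative permutation. Then $w$ is a minimal element of $\mathcal{C}_n$ (with respect to the right weak order) if and only if all of the following hold: (a) the set of descents of $w$ has the form $\{d, d+2, d+4, \ldots, d+2k\}$ for some $k \ge 2$; (b) the set $\{w(d), w(d+2), \ldots, w(d+2k)\}$ is crowded; (c) $w$ fixes every $i \in [1,n] \setminus [d, d+2k+1]$; (d) the pattern $415263$ occurs in $w$, and every occurrence of $415263$ in $w$ is consecutive (occupies consecutive positions); (e) for each $i \in [0,k-2]$, the consecutive subsequence $w(d+2i)\, w(d+2i+1) \cdots w(d+2i+5)$ is an occurrence of either the pattern $415263$ or the pattern $315264$.
   Context: A permutation is fully commutative iff it avoids $321$. $d$ is a descent of $w$ if $w(d)>w(d+1)$. The right weak order is the transitive closure of $w<ws_i$ when $\ell(ws_i)>\ell(w)$. $P(w)$ is the RSK insertion tableau and $\mathrm{Row}_2(P(w))$ the set of its second-row entries. A set $L$ of integers is crowded if there exist integers $x>0$, $y$ with $|[y,y+2x]\cap L|>x+1$. $\mathcal{C}_n$ is the set of fully commutative $w\in S_n$ with $\mathrm{Row}_2(P(w))$ crowded; a minimal element of $\mathcal{C}_n$ is an element of $\mathcal{C}_n$ with no other element of $\mathcal{C}_n$ below it in the right weak order. A permutation contains pattern $\sigma$ if it has a subsequence in the same relative order as $\sigma$. -}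

module Defs where

open import Data.Nat using (ℕ; zero; suc; _+_; _*_; _∸_; _≤_; _<_; _<?_)
open import Data.Nat.Properties using ()
open import Data.Integer as ℤ using (ℤ; +_)
open import Data.List using (List; []; _∷_; length; filter; map; upTo; foldl; lookup)
open import Data.List.Relation.Binary.Permutation.Propositional using (_↭_)
open import Data.Maybe using (Maybe; just; nothing)
open import Data.Product using (Σ; ∃; ∃-syntax; _×_; _,_)
open import Data.Sum using (_⊎_)
open import Data.Fin as Fin using (Fin; toℕ)
open import Relation.Nullary using (¬_)
open import Relation.Nullary.Decidable using (_×-dec_)
open import Relation.Binary.PropositionalEquality using (_≡_)
open import Relation.Binary.Construct.Closure.Transitive using (TransClosure)
open import Function.Bundles using (_⇔_)

-- Permutations of [1,n] in one-line notation: w = w(1) w(2) ... w(n).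
IsPerm : ℕ → List ℕ → Set
IsPerm n w = w ↭ map suc (upTo n)

-- w(i), 1-indexed (value 0 outside the range [1, length w]).
at : List ℕ → ℕ → ℕ
at [] _ = 0
at (x ∷ xs) zero = 0
at (x ∷ xs) (suc zero) = x
at (x ∷ xs) (suc (suc i)) = at xs (suc i)

Occurrence : (σ : List ℕ) → List ℕ → (Fin (length σ) → ℕ) → Set
Occurrence σ w p =
  (∀ a → 1 ≤ p a × p a ≤ length w) ×
  (∀ a b → a Fin.< b → p a < p b) ×
  (∀ a b → (lookup σ a < lookup σ b) ⇔ (at w (p a) < at w (p b)))

Contains : List ℕ → List ℕ → Set
Contains σ w = ∃[ p ] Occurrence σ w p

Consecutive : {m : ℕ} → (Fin m → ℕ) → Set
Consecutive p = ∀ a b → toℕ b ≡ suc (toℕ a) → p b ≡ suc (p a)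

p321 p415263 p315264 : List ℕ
p321 = 3 ∷ 2 ∷ 1 ∷ []
p415263 = 4 ∷ 1 ∷ 5 ∷ 2 ∷ 6 ∷ 3 ∷ []
p315264 = 3 ∷ 1 ∷ 5 ∷ 2 ∷ 6 ∷ 4 ∷ []

FullyCommutative : List ℕ → Set
FullyCommutative w = ¬ Contains p321 w

IsDescent : List ℕ → ℕ → Set
IsDescent w d = 1 ≤ d × d < length w × at w (suc d) < at w d

Tableau : Set
Tableau = List (List ℕ)

rowIns : ℕ → List ℕ → Maybe ℕ × List ℕ
rowIns x [] = nothing , x ∷ []
rowIns x (y ∷ ys) with x <? y
... | Relation.Nullary.yes _ = just y , x ∷ ys
... | Relation.Nullary.no _ with rowIns x ys
...   | b , r = b , y ∷ r

ins : ℕ → Tableau → Tableau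
ins x [] = (x ∷ []) ∷ []
ins x (r ∷ rs) with rowIns x r
... | nothing , r′ = r′ ∷ rs
... | just y , r′ = r′ ∷ ins y rs

P : List ℕ → Tableau
P w = foldl (λ T x → ins x T) [] w

Row₂ : Tableau → List ℕ
Row₂ (_ ∷ r ∷ _) = r
Row₂ _ = []

-- Crowded sets (a finite set of integers given as a duplicate-free list
-- of naturals)

countIn : ℤ → ℕ → List ℕ → ℕ
countIn y x L = length (filter (λ e → (y ℤ.≤? + e) ×-dec (+ e ℤ.≤? y ℤ.+ + (2 * x))) L)

Crowded : List ℕ → Set
Crowded L = ∃[ x ] ∃[ y ] (0 < x × suc x < countIn y x L)

-- number of inversions = Coxeter length
inv : List ℕ → ℕ
inv [] = 0
inv (x ∷ xs) = length (filter (_<? x) xs) + inv xs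

-- w s_i : swap the entries in positions i and i+1 (1-indexed)
swapAt : ℕ → List ℕ → List ℕ
swapAt (suc zero) (x ∷ y ∷ r) = y ∷ x ∷ r
swapAt (suc (suc i)) (x ∷ r) = x ∷ swapAt (suc i) r
swapAt _ w = w

WeakStep : ℕ → List ℕ → List ℕ → Set
WeakStep n w v = ∃[ i ] (1 ≤ i × i < n × v ≡ swapAt i w × inv w < inv v)

_<R[_]_ : List ℕ → ℕ → List ℕ → Set
u <R[ n ] w = TransClosure (WeakStep n) u w

𝒞 : ℕ → List ℕ → Set
𝒞 n w = IsPerm n w × FullyCommutative w × Crowded (Row₂ (P w))

Minimal𝒞 : ℕ → List ℕ → Set
Minimal𝒞 n w = 𝒞 n w × (∀ u → 𝒞 n u → ¬ (u <R[ n ] w))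

Characterization : ℕ → List ℕ → Set
Characterization n w = ∃[ d ] ∃[ k ]
  ( 2 ≤ k
  × (∀ j → IsDescent w j ⇔ (∃[ i ] (i ≤ k × j ≡ d + 2 * i)))
  × Crowded (map (λ i → at w (d + 2 * i)) (upTo (suc k)))
  × (∀ i → 1 ≤ i → i ≤ n → (i < d ⊎ d + 2 * k + 1 < i) → at w i ≡ i)
  × (Contains p415263 w × (∀ p → Occurrence p415263 w p → Consecutive p))
  × (∀ i → i + 2 ≤ k →
       Occurrence p415263 w (λ j → d + 2 * i + toℕ j)
       ⊎ Occurrence p315264 w (λ j → d + 2 * i + toℕ j)))

{-# OPTIONS --safe #-}

-- For a 321-avoiding word the entries bumped from the first row during RSK
-- leave it in increasing order, so they form the second row.  Undoing a descent
-- either leaves this set of bumped entries unchanged or removes one entry from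
-- it; hence 𝒞 is an upper set among the fully commutative permutations and
-- minimality only has to be tested on the permutations w sᵢ with i a descent.
--
-- If undoing any descent changes the set, then w is a direct sum of fixed points
-- and of blocks a₀ b₀ a₁ b₁ … a_k b_k with bᵢ < bᵢ₊₁ < aᵢ < aᵢ₊₁.  The a's are the
-- second row, and undoing any descent of a block removes its last peak a_k.  At
-- most half of the values in an initial segment above a block are peaks, so a
-- crowded window reaching past the end of a block can be cut off there: a
-- minimal w has exactly one block.
--
-- Let d be the first position of that block.  Counting the entries below aᵢ
-- gives aᵢ ≥ d + 2i + 2 for i < k and a_k = d + 2k + 1, while bᵢ₊₂ < aᵢ means
-- aᵢ ≥ d + 2i + 3 and bᵢ₊₃ < aᵢ means aᵢ ≥ d + 2i + 4.  Hence {a₀, …, a_k} is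
-- crowded once some bᵢ₊₂ < aᵢ (a pattern 415263), and {a₀, …, a_{k-1}} is not
-- crowded iff never bᵢ₊₃ < aᵢ (all occurrences of 415263 are consecutive).
module Submission where

open import Defs
open import Data.Nat
open import Data.Nat.Properties
open import Data.Integer as ℤ using (-[1+_])
import Data.Integer.Properties as ℤ
open import Data.Nat.Tactic.RingSolver using (solve-∀)
open import Data.List using (List; []; _∷_; _++_; _∷ʳ_; [_]; length; filter; map; upTo; applyUpTo; foldl; fromMaybe; lookup)
open import Data.List.Properties using (++-assoc; ++-identityʳ; ∷ʳ-++; filter-++; filter-accept; filter-reject; length-++; length-map; length-upTo; filter-none; filter-all; applyUpTo-∷ʳ; map-upTo)
open import Data.List.Relation.Unary.All as All using (All; []; _∷_)
import Data.List.Relation.Unary.All.Properties as All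
open import Data.List.Relation.Unary.Any using (here; there)
open import Data.List.Relation.Unary.AllPairs as AllPairs using (AllPairs; []; _∷_)
open import Data.List.Relation.Unary.Linked using ([-]; _∷_)
open import Data.List.Relation.Unary.Linked.Properties using (Linked⇒AllPairs)
open import Data.List.Relation.Unary.Unique.Propositional using (Unique)
import Data.List.Relation.Unary.Unique.Propositional.Properties as Unique
open import Data.List.Membership.Propositional using (_∈_)
open import Data.List.Membership.Propositional.Properties using (∈-++⁺ˡ; ∈-++⁺ʳ; ∈-++⁻; ∈-lookup)
open import Data.List.Relation.Binary.Permutation.Propositional using (_↭_; ↭-refl; ↭-reflexive; ↭-trans; ↭-sym; prep; swap; ↭⇒↭ₛ)
open import Data.List.Relation.Binary.Permutation.Propositional.Properties using (↭-length; filter-↭; All-resp-↭; drop-∷; ++-comm)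
import Data.List.Relation.Binary.Permutation.Setoid.Properties as Permutation
open import Data.Maybe using (just; nothing)
open import Data.Product using (∃-syntax; _×_; _,_; proj₁; proj₂)
open import Data.Sum using (_⊎_; inj₁; inj₂)
open import Data.Empty using (⊥)
open import Data.Fin as Fin using (Fin; toℕ; zero; suc; fromℕ; #_)
open import Data.Fin.Properties using (toℕ≤pred[n])
open import Function using (_∘_)
open import Function.Bundles using (_⇔_; mk⇔; Equivalence)
open import Level using (0ℓ)
open import Relation.Nullary using (¬_; yes; no; contradiction)
open import Relation.Nullary.Decidable using (_×-dec_; from-yes)
open import Relation.Unary using (Pred; Decidable)
open import Relation.Binary.Construct.Closure.Transitive using (module TransClosure)
open TransClosure using () renaming ([_] to [_]⁺; _∷_ to _∷⁺_)
open import Relation.Binary.Definitions using (tri<; tri≈; tri>)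
open import Relation.Binary.PropositionalEquality hiding ([_])

-- Row insertion and the second row

rowIns-append : ∀ {x R} → All (_≤ x) R → rowIns x R ≡ (nothing , R ∷ʳ x)
rowIns-append [] = refl
rowIns-append {x} {y ∷ R} (y≤x ∷ R≤x) with x <? y
... | yes x<y = contradiction x<y (≤⇒≯ y≤x)
... | no _ rewrite rowIns-append R≤x = refl

rowIns-bump : ∀ {x y A} B → All (_≤ x) A → x < y → rowIns x (A ++ y ∷ B) ≡ (just y , A ++ x ∷ B)
rowIns-bump {x} {y} B [] x<y with x <? y
... | yes _ = refl
... | no x≮y = contradiction x<y x≮y
rowIns-bump {x} {y} {z ∷ A} B (z≤x ∷ A≤x) x<y with x <? z
... | yes x<z = contradiction x<z (≤⇒≯ z≤x)
... | no _ rewrite rowIns-bump B A≤x x<y = refl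

-- Exposes in the index the place where `x` lands, so that `rowIns-append` and `rowIns-bump` can
-- serve as rewrite rules.
data RowView (x : ℕ) : List ℕ → Set where
  append : ∀ {R} → All (_≤ x) R → RowView x R
  bump : ∀ {A y} B → All (_≤ x) A → x < y → RowView x (A ++ y ∷ B)

rowView : ∀ x R → RowView x R
rowView x [] = append []
rowView x (y ∷ R) with x <? y
... | yes x<y = bump R [] x<y
... | no x≮y with rowView x R
...   | append R≤x = append (≮⇒≥ x≮y ∷ R≤x)
...   | bump B A≤x x<z = bump B (≮⇒≥ x≮y ∷ A≤x) x<z

-- The entries bumped out of a first row R while the word is inserted, in
-- order of time.
bumped : List ℕ → List ℕ → List ℕ
bumped R [] = []
bumped R (x ∷ v) = fromMaybe (proj₁ (rowIns x R)) ++ bumped (proj₂ (rowIns x R)) v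

bumped-append : ∀ {x R} v → All (_≤ x) R → bumped R (x ∷ v) ≡ bumped (R ∷ʳ x) v
bumped-append v R≤x rewrite rowIns-append R≤x = refl

bumped-bump : ∀ {x y A} B v → All (_≤ x) A → x < y →
  bumped (A ++ y ∷ B) (x ∷ v) ≡ y ∷ bumped (A ++ x ∷ B) v
bumped-bump B v A≤x x<y rewrite rowIns-bump B A≤x x<y = refl

bumped-swap : ∀ {A x y z} B r → All (_≤ x) A → x < z → x < y → All (_≤ y) (A ++ z ∷ B) →
  bumped (A ++ z ∷ B) (x ∷ y ∷ r) ≡ bumped (A ++ z ∷ B) (y ∷ x ∷ r)
bumped-swap {A} {x} {y} {z} B r A≤x x<z x<y R≤y = begin
  bumped (A ++ z ∷ B) (x ∷ y ∷ r) ≡⟨ bumped-bump {A = A} B (y ∷ r) A≤x x<z ⟩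
  z ∷ bumped (A ++ x ∷ B) (y ∷ r) ≡⟨ cong (z ∷_) (bumped-append r R′≤y) ⟩
  z ∷ bumped ((A ++ x ∷ B) ∷ʳ y) r ≡⟨ cong (λ X → z ∷ bumped X r) (++-assoc A (x ∷ B) [ y ]) ⟩
  z ∷ bumped (A ++ x ∷ B ∷ʳ y) r ≡⟨ bumped-bump {A = A} (B ∷ʳ y) r A≤x x<z ⟨
  bumped (A ++ z ∷ B ∷ʳ y) (x ∷ r) ≡⟨ cong (λ X → bumped X (x ∷ r)) (++-assoc A (z ∷ B) [ y ]) ⟨
  bumped ((A ++ z ∷ B) ∷ʳ y) (x ∷ r) ≡⟨ bumped-append (x ∷ r) R≤y ⟨
  bumped (A ++ z ∷ B) (y ∷ x ∷ r) ∎
  where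
  open ≡-Reasoning
  R′≤y : All (_≤ y) (A ++ x ∷ B)
  R′≤y = All.++⁺ (All.++⁻ˡ A R≤y) (<⇒≤ x<y ∷ All.tail (All.++⁻ʳ A R≤y))

Sorted : List ℕ → Set
Sorted = AllPairs _≤_

sorted-∷ʳ : ∀ {R x} → Sorted R → All (_≤ x) R → Sorted (R ∷ʳ x)
sorted-∷ʳ [] [] = [] ∷ []
sorted-∷ʳ (p ∷ sR) (q ∷ R≤x) = All.++⁺ p (q ∷ []) ∷ sorted-∷ʳ sR R≤x

sorted-replace : ∀ {x y} A {B} → Sorted (A ++ y ∷ B) → All (_≤ x) A → x < y → Sorted (A ++ x ∷ B)
sorted-replace [] (p ∷ sB) [] x<y = All.map (≤-trans (<⇒≤ x<y)) p ∷ sB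
sorted-replace (z ∷ A) (p ∷ sR) (z≤x ∷ A≤x) x<y =
  All.++⁺ (All.++⁻ˡ A p) (z≤x ∷ All.tail (All.++⁻ʳ A p)) ∷ sorted-replace A sR A≤x x<y

sorted-++-≤ : ∀ {y} A {B} → Sorted (A ++ y ∷ B) → All (_≤ y) A × All (y ≤_) B
sorted-++-≤ [] (p ∷ _) = [] , p
sorted-++-≤ {y} (z ∷ A) (p ∷ sR) with sorted-++-≤ A sR
... | A≤y , y≤B = All.head (All.++⁻ʳ A p) ∷ A≤y , y≤B

rowIns-Sorted : ∀ x R → Sorted R → Sorted (proj₂ (rowIns x R))
rowIns-Sorted x R sR with rowView x R
... | append R≤x rewrite rowIns-append R≤x = sorted-∷ʳ sR R≤x
... | bump {A} {y} B A≤x x<y rewrite rowIns-bump {x} {y} {A} B A≤x x<y = sorted-replace A sR A≤x x<y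

rowIns-All : ∀ {T : ℕ → Set} x R → T x → All T R → All T (proj₂ (rowIns x R))
rowIns-All x R t aR with rowView x R
... | append R≤x rewrite rowIns-append R≤x = All.++⁺ aR (t ∷ [])
... | bump {A} {y} B A≤x x<y rewrite rowIns-bump {x} {y} {A} B A≤x x<y =
  All.++⁺ (All.++⁻ˡ A aR) (t ∷ All.tail (All.++⁻ʳ A aR))

-- z followed by v has no 321 pattern that starts with z (and no repetition).
Safe : ℕ → List ℕ → Set
Safe z = AllPairs (λ x x′ → x < z → x < x′)

data Avoids : List ℕ → Set where
  [] : Avoids []
  _∷_ : ∀ {z v} → Safe z v → Avoids v → Avoids (z ∷ v)

safe-tail : ∀ {x v} {R : List ℕ} → All (λ z → Safe z (x ∷ v)) R → All (λ z → Safe z v) R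
safe-tail = All.map AllPairs.tail

safe-<-≮ : ∀ {z x x′ v} → Safe z (x ∷ v) → x < z → x′ ∈ v → ¬ (x′ ≤ x)
safe-<-≮ (p ∷ _) x<z x′∈v x′≤x = <⇒≱ (All.lookup p x′∈v x<z) x′≤x

-- An empty second row is left out because `ins` never creates an empty row.
tableau : List ℕ → List ℕ → Tableau
tableau R [] = R ∷ []
tableau R S@(_ ∷ _) = R ∷ S ∷ []

Row₂-tableau : ∀ R S → Row₂ (tableau R S) ≡ S
Row₂-tableau R [] = refl
Row₂-tableau R (_ ∷ _) = refl

ins-append : ∀ {x R} S → All (_≤ x) R → ins x (tableau R S) ≡ tableau (R ∷ʳ x) S
ins-append [] R≤x rewrite rowIns-append R≤x = refl
ins-append (s ∷ S) R≤x rewrite rowIns-append R≤x = refl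

ins-bump : ∀ {x y A} B S → All (_≤ x) A → x < y → All (_≤ y) S →
  ins x (tableau (A ++ y ∷ B) S) ≡ tableau (A ++ x ∷ B) (S ∷ʳ y)
ins-bump B [] A≤x x<y _ rewrite rowIns-bump B A≤x x<y = refl
ins-bump {y = y} B S@(_ ∷ _) A≤x x<y S≤y rewrite rowIns-bump B A≤x x<y | rowIns-append S≤y = refl

-- The invariant (last hypothesis): an entry y that can still be bumped exceeds the second row.
Row₂-insert : ∀ R S v → Sorted R → All (λ z → Safe z v) R → All (λ z → Safe z v) S → Avoids v →
  (∀ {s y x} → s ∈ S → y ∈ R → x ∈ v → x < y → s ≤ y) →
  Row₂ (foldl (λ T x → ins x T) (tableau R S) v) ≡ S ++ bumped R v
Row₂-insert R S [] sR _ _ _ _ = trans (Row₂-tableau R S) (sym (++-identityʳ S))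
Row₂-insert R S (x ∷ v) sR safeR safeS (safex ∷ av) inv with rowView x R
... | append R≤x rewrite ins-append S R≤x | rowIns-append R≤x =
  Row₂-insert (R ∷ʳ x) S v (sorted-∷ʳ sR R≤x) (All.++⁺ (safe-tail safeR) (safex ∷ [])) (safe-tail safeS) av inv′
  where
  inv′ : ∀ {s y x′} → s ∈ S → y ∈ R ∷ʳ x → x′ ∈ v → x′ < y → s ≤ y
  inv′ s∈S y∈R′ x′∈v x′<y with ∈-++⁻ R y∈R′
  ... | inj₁ y∈R = inv s∈S y∈R (there x′∈v) x′<y
  -- If some `s` in the second row exceeded the new entry `x`, then `s`, `x` and the letter `x′`
  -- bumping `x` would form a 321.
  ... | inj₂ (here refl) = ≮⇒≥ λ x<s → safe-<-≮ (All.lookup safeS s∈S) x<s x′∈v (<⇒≤ x′<y)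
-- The invariant applied to the letter `x` itself bounds the second row by `y`, so `y` is appended
-- there and no third row arises.
... | bump {A} {y} B A≤x x<y rewrite ins-bump {x} {y} {A} B S A≤x x<y (All.tabulate λ s∈S → inv s∈S (∈-++⁺ʳ A (here refl)) (here refl) x<y) | rowIns-bump {x} {y} {A} B A≤x x<y =
  trans
    (Row₂-insert (A ++ x ∷ B) (S ∷ʳ y) v (sorted-replace A sR A≤x x<y)
      (All.++⁺ (All.++⁻ˡ A (safe-tail safeR)) (safex ∷ All.tail (All.++⁻ʳ A (safe-tail safeR))))
      (All.++⁺ (safe-tail safeS) (AllPairs.tail safey ∷ [])) av inv′)
    (∷ʳ-++ S y _)
  where
  safey : Safe y (x ∷ v)
  safey = All.head (All.++⁻ʳ A safeR)
  x≤ : ∀ {x′} → x′ ∈ v → ¬ (x′ ≤ x)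
  x≤ = safe-<-≮ safey x<y
  inv′ : ∀ {s y′ x′} → s ∈ S ∷ʳ y → y′ ∈ A ++ x ∷ B → x′ ∈ v → x′ < y′ → s ≤ y′
  inv′ s∈ y′∈ x′∈v x′<y′ with ∈-++⁻ A y′∈ | ∈-++⁻ S s∈
  -- An entry of `A`, or `x` itself, can only be bumped by a letter smaller than `x`; together with
  -- `y` and `x` that letter would form a 321.
  ... | inj₁ y′∈A | _ = contradiction (≤-trans (<⇒≤ x′<y′) (All.lookup A≤x y′∈A)) (x≤ x′∈v)
  ... | inj₂ (here refl) | _ = contradiction (<⇒≤ x′<y′) (x≤ x′∈v)
  ... | inj₂ (there y′∈B) | inj₁ s∈S = inv s∈S (∈-++⁺ʳ A (there y′∈B)) (there x′∈v) x′<y′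
  ... | inj₂ (there y′∈B) | inj₂ (here refl) = All.lookup (proj₂ (sorted-++-≤ A sR)) y′∈B

Row₂-P : ∀ {w} → Avoids w → Row₂ (P w) ≡ bumped [] w
Row₂-P [] = refl
Row₂-P {x ∷ v} (safex ∷ av) =
  Row₂-insert (x ∷ []) [] v ([] ∷ []) (safex ∷ []) [] av λ ()

-- Steps of the right weak order

-- A cover of the right weak order without reference to positions: the left word arises from the
-- right one by undoing one descent.
data _⋖_ : List ℕ → List ℕ → Set where
  swap : ∀ {x y r} → x < y → (x ∷ y ∷ r) ⋖ (y ∷ x ∷ r)
  skip : ∀ {z v w} → v ⋖ w → (z ∷ v) ⋖ (z ∷ w)

⋖-++ : ∀ u {v w} → v ⋖ w → (u ++ v) ⋖ (u ++ w)
⋖-++ [] s = s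
⋖-++ (z ∷ u) s = skip (⋖-++ u s)

⋖-All : ∀ {Q : ℕ → Set} {v w} → v ⋖ w → All Q w → All Q v
⋖-All (swap _) (py ∷ px ∷ pr) = px ∷ py ∷ pr
⋖-All (skip s) (pz ∷ pw) = pz ∷ ⋖-All s pw

⋖-All⁻ : ∀ {Q : ℕ → Set} {v w} → v ⋖ w → All Q v → All Q w
⋖-All⁻ (swap _) (px ∷ py ∷ pr) = py ∷ px ∷ pr
⋖-All⁻ (skip s) (pz ∷ pv) = pz ∷ ⋖-All⁻ s pv

⋖-Safe : ∀ {z v w} → v ⋖ w → Safe z w → Safe z v
⋖-Safe (swap x<y) ((_ ∷ py) ∷ px ∷ pr) = ((λ _ → x<y) ∷ px) ∷ py ∷ pr
⋖-Safe (skip s) (p ∷ pw) = ⋖-All s p ∷ ⋖-Safe s pw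

⋖-Avoids : ∀ {v w} → v ⋖ w → Avoids w → Avoids v
⋖-Avoids (swap x<y) ((_ ∷ py) ∷ px ∷ pr) = (All.tabulate (λ _ y<x → contradiction x<y (<-asym y<x)) ∷ px) ∷ py ∷ pr
⋖-Avoids (skip s) (p ∷ pw) = ⋖-Safe s p ∷ ⋖-Avoids s pw

-- Monotonicity of the bumped entries

module _ {Q : Pred ℕ 0ℓ} (Q? : Decidable Q) where

  count : List ℕ → ℕ
  count L = length (filter Q? L)

  count-++ : ∀ L M → count (L ++ M) ≡ count L + count M
  count-++ L M = trans (cong length (filter-++ Q? L M)) (length-++ (filter Q? L))

  count-∷ : ∀ x L → count (x ∷ L) ≡ count [ x ] + count L
  count-∷ x L = count-++ [ x ] L

  count-∷-mono : ∀ x {L M} → count L ≤ count M → count (x ∷ L) ≤ count (x ∷ M)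
  count-∷-mono x {L} {M} p rewrite count-∷ x L | count-∷ x M = +-monoʳ-≤ (count [ x ]) p

  count-∷-≤ : ∀ x L → count L ≤ count (x ∷ L)
  count-∷-≤ x L rewrite count-∷ x L = m≤n+m (count L) (count [ x ])

  count-swap : ∀ x y L → count (x ∷ y ∷ L) ≡ count (y ∷ x ∷ L)
  count-swap x y L = begin
    count (x ∷ y ∷ L) ≡⟨ count-∷ x (y ∷ L) ⟩
    count [ x ] + count (y ∷ L) ≡⟨ cong (count [ x ] +_) (count-∷ y L) ⟩
    count [ x ] + (count [ y ] + count L) ≡⟨ +-assoc (count [ x ]) _ _ ⟨
    count [ x ] + count [ y ] + count L ≡⟨ cong (_+ count L) (+-comm (count [ x ]) _) ⟩
    count [ y ] + count [ x ] + count L ≡⟨ +-assoc (count [ y ]) _ _ ⟩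
    count [ y ] + (count [ x ] + count L) ≡⟨ cong (count [ y ] +_) (count-∷ x L) ⟨
    count [ y ] + count (x ∷ L) ≡⟨ count-∷ y (x ∷ L) ⟨
    count (y ∷ x ∷ L) ∎
    where open ≡-Reasoning

  -- An additional entry c of the first row is either never bumped, or bumped
  -- in place of the next larger one, which then takes over its role.
  bumped-extra : ∀ A c B v → Sorted (A ++ c ∷ B) →
    count (bumped (A ++ c ∷ B) v) ≤ count (c ∷ bumped (A ++ B) v)
  bumped-extra A c B [] sR = z≤n
  bumped-extra A c B (z ∷ v) sR with rowView z A
  ... | bump {A₁} {y} A₂ A₁≤z z<y
    rewrite ++-assoc A₁ (y ∷ A₂) (c ∷ B) | ++-assoc A₁ (y ∷ A₂) B
    | bumped-bump {z} {y} {A₁} (A₂ ++ c ∷ B) v A₁≤z z<y | bumped-bump {z} {y} {A₁} (A₂ ++ B) v A₁≤z z<y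
    = begin
    count (y ∷ bumped (A₁ ++ z ∷ A₂ ++ c ∷ B) v) ≤⟨ count-∷-mono y {bumped (A₁ ++ z ∷ A₂ ++ c ∷ B) v} {c ∷ bumped (A₁ ++ z ∷ A₂ ++ B) v} ih ⟩
    count (y ∷ c ∷ bumped (A₁ ++ z ∷ A₂ ++ B) v) ≡⟨ count-swap y c _ ⟩
    count (c ∷ y ∷ bumped (A₁ ++ z ∷ A₂ ++ B) v) ∎
    where
    open ≤-Reasoning
    sR′ : Sorted ((A₁ ++ z ∷ A₂) ++ c ∷ B)
    sR′ = subst Sorted (sym (++-assoc A₁ (z ∷ A₂) (c ∷ B))) (sorted-replace A₁ sR A₁≤z z<y)
    ih : count (bumped (A₁ ++ z ∷ A₂ ++ c ∷ B) v) ≤ count (c ∷ bumped (A₁ ++ z ∷ A₂ ++ B) v)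
    ih = subst₂ (λ X Y → count (bumped X v) ≤ count (c ∷ bumped Y v))
           (++-assoc A₁ (z ∷ A₂) (c ∷ B)) (++-assoc A₁ (z ∷ A₂) B)
           (bumped-extra (A₁ ++ z ∷ A₂) c B v sR′)
  ... | append A≤z with z <? c
  ...   | yes z<c rewrite bumped-bump {z} {c} {A} B v A≤z z<c = count-∷-mono c {bumped (A ++ z ∷ B) v} {bumped (A ++ B) (z ∷ v)} (below-c B sR)
    where
    -- In the row without `c`, the letter `z` bumps the head of `B`, which from then on is the
    -- additional entry of the other row. If `B` is empty, `z` is appended and the two rows agree.
    below-c : ∀ B → Sorted (A ++ c ∷ B) → count (bumped (A ++ z ∷ B) v) ≤ count (bumped (A ++ B) (z ∷ v))
    below-c [] _ rewrite ++-identityʳ A | bumped-append v A≤z = ≤-refl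
    below-c (c′ ∷ B) sR rewrite bumped-bump {z} {c′} {A} B v A≤z (<-≤-trans z<c (All.head (proj₂ (sorted-++-≤ A sR)))) =
      subst₂ (λ X Y → count (bumped X v) ≤ count (c′ ∷ bumped Y v)) (∷ʳ-++ A z (c′ ∷ B)) (∷ʳ-++ A z B)
        (bumped-extra (A ∷ʳ z) c′ B v (subst Sorted (sym (∷ʳ-++ A z (c′ ∷ B))) (sorted-replace A sR A≤z z<c)))
  ...   | no z≮c with rowView z B
  ...     | append B≤z
    rewrite bumped-append {z} {A ++ c ∷ B} v (All.++⁺ A≤z (≮⇒≥ z≮c ∷ B≤z))
    | bumped-append {z} {A ++ B} v (All.++⁺ A≤z B≤z) | ++-assoc A (c ∷ B) [ z ] | ++-assoc A B [ z ]
    = bumped-extra A c (B ∷ʳ z) v (subst Sorted (++-assoc A (c ∷ B) [ z ]) (sorted-∷ʳ sR (All.++⁺ A≤z (≮⇒≥ z≮c ∷ B≤z))))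
  ...     | bump {B₁} {y} B₂ B₁≤z z<y = begin
    count (bumped (A ++ c ∷ B₁ ++ y ∷ B₂) (z ∷ v)) ≡⟨ cong (λ X → count (bumped X (z ∷ v))) (++-assoc A (c ∷ B₁) (y ∷ B₂)) ⟨
    count (bumped ((A ++ c ∷ B₁) ++ y ∷ B₂) (z ∷ v)) ≡⟨ cong count (bumped-bump {A = A ++ c ∷ B₁} B₂ v ≤z z<y) ⟩
    count (y ∷ bumped ((A ++ c ∷ B₁) ++ z ∷ B₂) v) ≡⟨ cong (λ X → count (y ∷ bumped X v)) (++-assoc A (c ∷ B₁) (z ∷ B₂)) ⟩
    count (y ∷ bumped (A ++ c ∷ B₁ ++ z ∷ B₂) v) ≤⟨ count-∷-mono y {bumped (A ++ c ∷ B₁ ++ z ∷ B₂) v} {c ∷ bumped (A ++ B₁ ++ z ∷ B₂) v} (bumped-extra A c (B₁ ++ z ∷ B₂) v sR′) ⟩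
    count (y ∷ c ∷ bumped (A ++ B₁ ++ z ∷ B₂) v) ≡⟨ count-swap y c _ ⟩
    count (c ∷ y ∷ bumped (A ++ B₁ ++ z ∷ B₂) v) ≡⟨ cong (λ X → count (c ∷ y ∷ bumped X v)) (++-assoc A B₁ (z ∷ B₂)) ⟨
    count (c ∷ y ∷ bumped ((A ++ B₁) ++ z ∷ B₂) v) ≡⟨ cong (λ X → count (c ∷ X)) (bumped-bump {A = A ++ B₁} B₂ v (All.++⁺ A≤z B₁≤z) z<y) ⟨
    count (c ∷ bumped ((A ++ B₁) ++ y ∷ B₂) (z ∷ v)) ≡⟨ cong (λ X → count (c ∷ bumped X (z ∷ v))) (++-assoc A B₁ (y ∷ B₂)) ⟩
    count (c ∷ bumped (A ++ B₁ ++ y ∷ B₂) (z ∷ v)) ∎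
    where
    open ≤-Reasoning
    ≤z : All (_≤ z) (A ++ c ∷ B₁)
    ≤z = All.++⁺ A≤z (≮⇒≥ z≮c ∷ B₁≤z)
    sR′ : Sorted (A ++ c ∷ B₁ ++ z ∷ B₂)
    sR′ = subst Sorted (++-assoc A (c ∷ B₁) (z ∷ B₂))
            (sorted-replace (A ++ c ∷ B₁) (subst Sorted (sym (++-assoc A (c ∷ B₁) (y ∷ B₂))) sR) ≤z z<y)

  -- Let the descent `y` `x` be undone. If `x` bumps nothing, `y` is no longer bumped but stays in
  -- the row as an additional entry, and `bumped-extra` applies; if `x` bumps an entry,
  -- `bumped-swap` shows that nothing changes. Since `Q` is arbitrary, this is an inclusion of
  -- multisets.
  bumped-mono : ∀ {v w} R → v ⋖ w → Sorted R → All (λ z → Safe z w) R → Avoids w →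
    count (bumped R v) ≤ count (bumped R w)
  bumped-mono R (skip {z} {v} {w} s) sR safeR (safez ∷ av) = begin
    count (fromMaybe b ++ bumped R′ v) ≡⟨ count-++ (fromMaybe b) _ ⟩
    count (fromMaybe b) + count (bumped R′ v) ≤⟨ +-monoʳ-≤ (count (fromMaybe b))
      (bumped-mono R′ s (rowIns-Sorted z R sR) (rowIns-All z R safez (safe-tail safeR)) av) ⟩
    count (fromMaybe b) + count (bumped R′ w) ≡⟨ count-++ (fromMaybe b) _ ⟨
    count (fromMaybe b ++ bumped R′ w) ∎
    where
    open ≤-Reasoning
    b = proj₁ (rowIns z R)
    R′ = proj₂ (rowIns z R)
  bumped-mono R (swap {x} {y} {r} x<y) sR safeR av with rowView x R
  ... | append R≤x
    rewrite bumped-append {x} {R} (y ∷ r) R≤x | bumped-append {y} {R} (x ∷ r) (All.map (λ p → ≤-trans p (<⇒≤ x<y)) R≤x)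
    | bumped-append {y} {R ∷ʳ x} r (All.++⁺ (All.map (λ p → ≤-trans p (<⇒≤ x<y)) R≤x) (<⇒≤ x<y ∷ []))
    | bumped-bump {x} {y} {R} [] r R≤x x<y
    = subst (λ X → count (bumped ((R ∷ʳ x) ∷ʳ y) r) ≤ count (y ∷ bumped X r)) (++-identityʳ (R ∷ʳ x))
        (bumped-extra (R ∷ʳ x) y [] r (sorted-∷ʳ (sorted-∷ʳ sR R≤x) (All.++⁺ (All.map (λ p → ≤-trans p (<⇒≤ x<y)) R≤x) (<⇒≤ x<y ∷ []))))
  ... | bump {A} {z} B A≤x x<z = ≤-reflexive (cong count (bumped-swap B r A≤x x<z x<y R≤y))
    where
    R≤y : All (_≤ y) (A ++ z ∷ B)
    -- A row entry above `y` would form a 321 with `y` and `x`.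
    R≤y = All.map (λ safe → ≮⇒≥ λ y<z → <-asym x<y (All.head (AllPairs.head safe) y<z)) safeR

-- Pattern occurrences

module _ {R : ℕ → ℕ → Set} where

  allPairs-at : ∀ {v} → AllPairs R v → ∀ {i j} → i < j → j < length v → R (at v (suc i)) (at v (suc j))
  allPairs-at {x ∷ v} (p ∷ _) {zero} {suc j} _ (s≤s j<n) = all-at p j<n
    where
    all-at : ∀ {Q : ℕ → Set} {v} → All Q v → ∀ {j} → j < length v → Q (at v (suc j))
    all-at (q ∷ _) {zero} _ = q
    all-at (_ ∷ qs) {suc j} (s≤s j<n) = all-at qs j<n
  allPairs-at {x ∷ v} (_ ∷ ps) {suc i} {suc j} (s≤s i<j) (s≤s j<n) = allPairs-at ps i<j j<n

  at-allPairs : ∀ v → (∀ i j → i < j → j < length v → R (at v (suc i)) (at v (suc j))) → AllPairs R v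
  at-allPairs [] h = []
  at-allPairs (x ∷ v) h = at-all v (λ j j<n → h 0 (suc j) z<s (s≤s j<n)) ∷ at-allPairs v (λ i j i<j j<n → h (suc i) (suc j) (s≤s i<j) (s≤s j<n))
    where
    at-all : ∀ {Q : ℕ → Set} v → (∀ j → j < length v → Q (at v (suc j))) → All Q v
    at-all [] h = []
    at-all (x ∷ v) h = h 0 z<s ∷ at-all v (λ j j<n → h (suc j) (s≤s j<n))

  allPairs-lookup : ∀ {v} → AllPairs R v → ∀ a b → a Fin.< b → R (lookup v a) (lookup v b)
  allPairs-lookup {x ∷ v} (p ∷ _) zero (suc b) _ = All.lookup p (∈-lookup b)
  allPairs-lookup {x ∷ v} (_ ∷ ps) (suc a) (suc b) (s≤s a<b) = allPairs-lookup ps a b a<b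

-- The values of an occurrence, listed increasingly, determine its pattern.
pattern-occurrence : ∀ σ w (p : Fin (length σ) → ℕ) vs → AllPairs _<_ vs →
  (∀ a → ∃[ r ] (lookup σ a ≡ suc r × r < length vs × at w (p a) ≡ at vs (suc r))) →
  (∀ a → 1 ≤ p a × p a ≤ length w) → (∀ a b → a Fin.< b → p a < p b) → Occurrence σ w p
pattern-occurrence σ w p vs vs< ranks bounds mono = bounds , mono , λ a b → mk⇔ (to a b) (from a b)
  where
  to : ∀ a b → lookup σ a < lookup σ b → at w (p a) < at w (p b)
  to a b lt with ranks a | ranks b
  ... | r , σa , _ , ea | s , σb , s< , eb rewrite σa | σb | ea | eb = allPairs-at vs< (≤-pred lt) s<
  from : ∀ a b → at w (p a) < at w (p b) → lookup σ a < lookup σ b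
  from a b lt with <-cmp (lookup σ a) (lookup σ b)
  ... | tri< σ< _ _ = σ<
  ... | tri> _ _ σ> = contradiction lt (<-asym (to b a σ>))
  ... | tri≈ _ σ≡ _ with ranks a | ranks b
  ...   | r , σa , _ , ea | s , σb , _ , eb =
    contradiction lt (<-irrefl (trans ea (trans (cong (at vs) (trans (sym σa) (trans σ≡ σb))) (sym eb))))

safe-at : ∀ {v} → Avoids v → ∀ {i j l} → i < j → j < l → l < length v →
  at v (suc j) < at v (suc i) → at v (suc j) < at v (suc l)
safe-at (safe ∷ _) {zero} {suc j} {suc l} _ (s≤s j<l) (s≤s l<n) = allPairs-at safe j<l l<n
safe-at (_ ∷ av) {suc i} {suc j} {suc l} (s≤s i<j) (s≤s j<l) (s≤s l<n) = safe-at av i<j j<l l<n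

at-avoids : ∀ v → (∀ i j l → i < j → j < l → l < length v →
  at v (suc j) < at v (suc i) → at v (suc j) < at v (suc l)) → Avoids v
at-avoids [] h = []
at-avoids (z ∷ v) h = at-allPairs v (λ j l j<l l<n → h 0 (suc j) (suc l) z<s (s≤s j<l) (s≤s l<n))
  ∷ at-avoids v (λ i j l i<j j<l l<n → h (suc i) (suc j) (suc l) (s≤s i<j) (s≤s j<l) (s≤s l<n))

fullyCommutative⇒avoids : ∀ {w} → Unique w → FullyCommutative w → Avoids w
fullyCommutative⇒avoids {w} uw fc = at-avoids w λ i j l i<j j<l l<n wj<wi →
  ≤∧≢⇒< (≮⇒≥ λ wl<wj → fc (lookup (suc i ∷ suc j ∷ suc l ∷ []) , occ i<j j<l l<n wj<wi wl<wj)) (allPairs-at uw j<l l<n)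
  where
  occ : ∀ {i j l} → i < j → j < l → l < length w → at w (suc j) < at w (suc i) → at w (suc l) < at w (suc j) →
    Occurrence p321 w (lookup (suc i ∷ suc j ∷ suc l ∷ []))
  occ {i} {j} {l} i<j j<l l<n wj<wi wl<wj =
    pattern-occurrence p321 w _ (at w (suc l) ∷ at w (suc j) ∷ at w (suc i) ∷ [])
      ((wl<wj ∷ <-trans wl<wj wj<wi ∷ []) ∷ (wj<wi ∷ []) ∷ [] ∷ [])
      (λ where zero → 2 , refl , s≤s (s≤s (s≤s z≤n)) , refl
               (suc zero) → 1 , refl , s≤s (s≤s z≤n) , refl
               (suc (suc zero)) → 0 , refl , s≤s z≤n , refl)
      (λ where zero → s≤s z≤n , <-trans (<-trans i<j j<l) l<n
               (suc zero) → s≤s z≤n , <-trans j<l l<n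
               (suc (suc zero)) → s≤s z≤n , l<n)
      (allPairs-lookup {_<_} {suc i ∷ suc j ∷ suc l ∷ []} ((s≤s i<j ∷ s≤s (<-trans i<j j<l) ∷ []) ∷ (s≤s j<l ∷ []) ∷ [] ∷ []))

avoids⇒fullyCommutative : ∀ {w} → Avoids w → FullyCommutative w
avoids⇒fullyCommutative {w} av (p , bounds , mono , iff) =
  absurd (proj₁ (bounds zero)) (mono zero (suc zero) (s≤s z≤n))
    (mono (suc zero) (suc (suc zero)) (s≤s (s≤s z≤n))) (proj₂ (bounds (suc (suc zero))))
    (Equivalence.to (iff (suc zero) zero) (s≤s (s≤s (s≤s z≤n))))
    (Equivalence.to (iff (suc (suc zero)) (suc zero)) (s≤s (s≤s z≤n)))
  where
  absurd : ∀ {i j l} → 1 ≤ i → i < j → j < l → l ≤ length w → at w j < at w i → at w l < at w j → ⊥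
  absurd {suc i} {suc j} {suc l} _ (s≤s i<j) (s≤s j<l) l≤n wj<wi wl<wj = <-asym wl<wj (safe-at av i<j j<l l≤n wj<wi)

⋖⇒↭ : ∀ {v w} → v ⋖ w → v ↭ w
⋖⇒↭ (swap {x} {y} _) = swap x y ↭-refl
⋖⇒↭ (skip {z} s) = prep z (⋖⇒↭ s)

count-↭ : ∀ {Q : Pred ℕ 0ℓ} (Q? : Decidable Q) {v w} → v ↭ w → count Q? v ≡ count Q? w
count-↭ Q? v↭w = ↭-length (filter-↭ Q? v↭w)

swapAt-↭ : ∀ i v → swapAt i v ↭ v
swapAt-↭ zero v = ↭-refl
swapAt-↭ (suc zero) [] = ↭-refl
swapAt-↭ (suc zero) (x ∷ []) = ↭-refl
swapAt-↭ (suc zero) (x ∷ y ∷ r) = swap y x ↭-refl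
swapAt-↭ (suc (suc i)) [] = ↭-refl
swapAt-↭ (suc (suc i)) (x ∷ v) = prep x (swapAt-↭ (suc i) v)

-- Exchanging a pair that is not an ascent cannot create inversions, and a swap out of range changes
-- nothing. Further left, a first letter `z` contributes equally to both inversion counts, because
-- its contribution depends only on the multiset of later letters.
swapAt-⋖ : ∀ i v → inv v < inv (swapAt i v) → v ⋖ swapAt i v
swapAt-⋖ zero v lt = contradiction lt (<-irrefl refl)
swapAt-⋖ (suc zero) [] lt = contradiction lt (<-irrefl refl)
swapAt-⋖ (suc zero) (x ∷ []) lt = contradiction lt (<-irrefl refl)
swapAt-⋖ (suc zero) (x ∷ y ∷ r) lt with x <? y
... | yes x<y = swap x<y
... | no x≮y = contradiction lt (≤⇒≯ (begin
  count (_<? y) (x ∷ r) + (count (_<? x) r + inv r) ≡⟨ cong (λ L → length L + (count (_<? x) r + inv r)) (filter-reject (_<? y) x≮y) ⟩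
  count (_<? y) r + (count (_<? x) r + inv r) ≡⟨ +-assoc (count (_<? y) r) _ _ ⟨
  count (_<? y) r + count (_<? x) r + inv r ≡⟨ cong (_+ inv r) (+-comm (count (_<? y) r) _) ⟩
  count (_<? x) r + count (_<? y) r + inv r ≡⟨ +-assoc (count (_<? x) r) _ _ ⟩
  count (_<? x) r + (count (_<? y) r + inv r) ≤⟨ +-monoˡ-≤ _ (count-∷-≤ (_<? x) y r) ⟩
  count (_<? x) (y ∷ r) + (count (_<? y) r + inv r) ∎))
  where open ≤-Reasoning
swapAt-⋖ (suc (suc i)) [] lt = contradiction lt (<-irrefl refl)
swapAt-⋖ (suc (suc i)) (z ∷ v) lt = skip (swapAt-⋖ (suc i) v (+-cancelˡ-< (count (_<? z) v) _ _
  (subst (λ c → inv (z ∷ v) < c + inv (swapAt (suc i) v)) (count-↭ (_<? z) (swapAt-↭ (suc i) v)) lt)))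

weakStep⇒⋖ : ∀ {n v w} → WeakStep n v w → v ⋖ w
weakStep⇒⋖ {v = v} (i , _ , _ , refl , lt) = swapAt-⋖ i v lt

⋖⇒swapAt : ∀ {v w} → v ⋖ w → ∃[ i ] (suc i < length w × w ≡ swapAt (suc i) v × inv v < inv w)
⋖⇒swapAt {w = y ∷ x ∷ r} (swap x<y) = 0 , s≤s (s≤s z≤n) , refl , (begin-strict
  count (_<? x) (y ∷ r) + (count (_<? y) r + inv r) ≡⟨ cong (λ L → length L + (count (_<? y) r + inv r)) (filter-reject (_<? x) (<-asym x<y)) ⟩
  count (_<? x) r + (count (_<? y) r + inv r) ≡⟨ +-assoc (count (_<? x) r) _ _ ⟨
  count (_<? x) r + count (_<? y) r + inv r ≡⟨ cong (_+ inv r) (+-comm (count (_<? x) r) _) ⟩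
  count (_<? y) r + count (_<? x) r + inv r ≡⟨ +-assoc (count (_<? y) r) _ _ ⟩
  count (_<? y) r + (count (_<? x) r + inv r) <⟨ n<1+n _ ⟩
  suc (count (_<? y) r) + (count (_<? x) r + inv r) ≡⟨ cong (λ L → length L + (count (_<? x) r + inv r)) (filter-accept (_<? y) x<y) ⟨
  count (_<? y) (x ∷ r) + (count (_<? x) r + inv r) ∎)
  where open ≤-Reasoning
⋖⇒swapAt {z ∷ v} {_ ∷ w} (skip s) with ⋖⇒swapAt s
... | i , i<n , w≡ , lt = suc i , s≤s i<n , cong (z ∷_) w≡ ,
  subst (λ c → c + inv v < count (_<? z) w + inv w) (sym (count-↭ (_<? z) (⋖⇒↭ s))) (+-monoʳ-< (count (_<? z) w) lt)

-- Crowded sets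

count-⊆ᴬ : ∀ {Q Q′ : Pred ℕ 0ℓ} (Q? : Decidable Q) (Q′? : Decidable Q′) {L} → All (λ e → Q e → Q′ e) L → count Q? L ≤ count Q′? L
count-⊆ᴬ Q? Q′? [] = z≤n
count-⊆ᴬ Q? Q′? {x ∷ L} (sub ∷ subs) with Q? x
... | no _ = ≤-trans (count-⊆ᴬ Q? Q′? subs) (count-∷-≤ Q′? x L)
... | yes q rewrite filter-accept Q′? {x} {L} (sub q) = s≤s (count-⊆ᴬ Q? Q′? subs)

count-⊆ : ∀ {Q Q′ : Pred ℕ 0ℓ} (Q? : Decidable Q) (Q′? : Decidable Q′) → (∀ {e} → Q e → Q′ e) → ∀ L → count Q? L ≤ count Q′? L
count-⊆ Q? Q′? sub L = count-⊆ᴬ Q? Q′? (All.universal (λ _ → sub) L)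

In : ℕ → ℕ → Pred ℕ 0ℓ
In p q e = p ≤ e × e ≤ q

in? : ∀ p q → Decidable (In p q)
in? p q e = (p ≤? e) ×-dec (e ≤? q)

crowded⇒window : ∀ L → Crowded L → ∃[ p ] ∃[ x ] (0 < x × suc x < count (in? p (p + 2 * x)) L)
crowded⇒window L (x , ℤ.+ p , 0<x , lt) = p , x , 0<x , <-≤-trans lt (count-⊆ _ (in? p (p + 2 * x)) (λ (p≤e , e≤q) → ℤ.drop‿+≤+ p≤e , ℤ.drop‿+≤+ e≤q) L)
-- Moving a window with negative start to the start 0 loses no natural number.
crowded⇒window L (x , -[1+ m ] , 0<x , lt) = 0 , x , 0<x , <-≤-trans lt
  (count-⊆ _ (in? 0 (2 * x)) (λ (_ , e≤q) → z≤n , ℤ.drop‿+≤+ (ℤ.≤-trans e≤q (ℤ.+-monoˡ-≤ (ℤ.+ (2 * x)) (ℤ.-≤+ {m} {0})))) L)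

window⇒crowded : ∀ L p x → 0 < x → suc x < count (in? p (p + 2 * x)) L → Crowded L
window⇒crowded L p x 0<x lt = x , ℤ.+ p , 0<x , <-≤-trans lt (count-⊆ (in? p (p + 2 * x)) _ (λ (p≤e , e≤q) → ℤ.+≤+ p≤e , ℤ.+≤+ e≤q) L)

crowded-mono : ∀ {L M} → (∀ {Q : Pred ℕ 0ℓ} (Q? : Decidable Q) → count Q? L ≤ count Q? M) → Crowded L → Crowded M
crowded-mono le (x , y , 0<x , lt) = x , y , 0<x , <-≤-trans lt (le _)

-- Minimality is a local condition

perm-unique : ∀ {n w} → IsPerm n w → Unique w
perm-unique {n} w↭ = Permutation.Unique-resp-↭ (setoid ℕ) (↭⇒↭ₛ (↭-sym w↭)) (Unique.map⁺ suc-injective (Unique.upTo⁺ n))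

perm-length : ∀ {n w} → IsPerm n w → length w ≡ n
perm-length {n} w↭ = trans (↭-length w↭) (trans (length-map suc (upTo n)) (length-upTo n))

LocallyMinimal : List ℕ → Set
LocallyMinimal w = Crowded (bumped [] w) × (∀ v → v ⋖ w → ¬ Crowded (bumped [] v))

module _ {n w} (perm : IsPerm n w) (av : Avoids w) where

  minimal⇒locallyMinimal : Minimal𝒞 n w → LocallyMinimal w
  minimal⇒locallyMinimal ((_ , _ , cr) , below) = subst Crowded (Row₂-P av) cr , λ v v⋖w crv →
    let i , i<n , w≡ , lt = ⋖⇒swapAt v⋖w
        av′ = ⋖-Avoids v⋖w av in
    below v (↭-trans (⋖⇒↭ v⋖w) perm , avoids⇒fullyCommutative av′ , subst Crowded (sym (Row₂-P av′)) crv)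
      [ suc i , s≤s z≤n , subst (suc i <_) (perm-length perm) i<n , w≡ , lt ]⁺

  locallyMinimal⇒minimal : LocallyMinimal w → Minimal𝒞 n w
  locallyMinimal⇒minimal (cr , below) =
    (perm , avoids⇒fullyCommutative av , subst Crowded (sym (Row₂-P av)) cr) , λ u (permu , fcu , cru) u<w →
      let v , v⋖w , crv = last-step u<w av (subst Crowded (Row₂-P (fullyCommutative⇒avoids (perm-unique permu) fcu)) cru)
      in below v v⋖w crv
    where
    -- Crowdedness at the bottom of a chain climbs by `bumped-mono` to the last element before `w`.
    last-step : ∀ {u w} → u <R[ n ] w → Avoids w → Crowded (bumped [] u) → ∃[ v ] (v ⋖ w × Crowded (bumped [] v))
    avoids-below : ∀ {u w} → u <R[ n ] w → Avoids w → Avoids u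
    avoids-below [ s ]⁺ avw = ⋖-Avoids (weakStep⇒⋖ s) avw
    avoids-below (s ∷⁺ t) avw = ⋖-Avoids (weakStep⇒⋖ s) (avoids-below t avw)
    last-step {u} [ s ]⁺ avw cru = u , weakStep⇒⋖ s , cru
    last-step {u} (_∷⁺_ {y = u′} s t) avw cru = last-step t avw
      (crowded-mono {bumped [] u} {bumped [] u′} (λ Q? → bumped-mono Q? [] (weakStep⇒⋖ s) [] [] (avoids-below t avw)) cru)

-- Shape of the locally minimal words

-- Under this condition no letter of `v` can bump an entry of `R`, so `R` is a settled initial part
-- of the first row.
_≪_ : List ℕ → List ℕ → Set
R ≪ v = All (λ x → All (_< x) R) v

≪-≤ : ∀ {R : List ℕ} {x} → All (_< x) R → All (_≤ x) R
≪-≤ = All.map <⇒≤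

≪-∷ʳ : ∀ {R v e} → R ≪ v → All (e <_) v → (R ∷ʳ e) ≪ v
≪-∷ʳ [] [] = []
≪-∷ʳ (p ∷ ps) (q ∷ qs) = All.++⁺ p (q ∷ []) ∷ ≪-∷ʳ ps qs

-- Direct sums of fixed points and of alternating blocks c₀ e₀ c₁ e₁ … with
-- eᵢ < eᵢ₊₁ < cᵢ < cᵢ₊₁; in Linked c v the word v continues a block whose last peak is c.
mutual
  data Sum : List ℕ → Set where
    nil : Sum []
    fix : ∀ {c v} → All (c <_) v → Sum v → Sum (c ∷ v)
    block : ∀ {c e v} → e < c → All (e <_) v → Linked c v → Sum (c ∷ e ∷ v)
  data Linked (c : ℕ) : List ℕ → Set where
    close : ∀ {v} → All (c <_) v → Sum v → Linked c v
    link : ∀ {f e v} → e < f → e < c → c < f → All (e <_) v → Linked f v → Linked c (f ∷ e ∷ v)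

-- The consequence of local minimality that determines the shape of the word: if undoing a descent
-- kept the bumped entries, the smaller word would be crowded too.
Rigid : List ℕ → List ℕ → Set
Rigid R w = ∀ v → v ⋖ w → bumped R v ≢ bumped R w

rigid-tail : ∀ {R x w} → Rigid R (x ∷ w) → Rigid (proj₂ (rowIns x R)) w
rigid-tail {R} {x} rigid v v⋖w eq = rigid (x ∷ v) (skip v⋖w) (cong (fromMaybe (proj₁ (rowIns x R)) ++_) eq)

rowIns-++ : ∀ {x A} B → All (_≤ x) A → proj₂ (rowIns x (A ++ B)) ≡ A ++ proj₂ (rowIns x B)
rowIns-++ B [] = refl
rowIns-++ {x} {y ∷ A} B (y≤x ∷ A≤x) with x <? y
... | yes x<y = contradiction x<y (≤⇒≯ y≤x)
... | no _ = cong (y ∷_) (rowIns-++ B A≤x)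

-- While only letters above `c` arrive, `c` stays in the row and `T` changes to its right. At the
-- first letter `x` below `c`, the preceding letter `y` exceeds `c`, and by `bumped-swap` undoing
-- the descent `y` `x` would keep the bumped entries.
rigid-ascent : ∀ R c T y v → R ≪ (y ∷ v) → c < y → All (λ z → Safe z (y ∷ v)) T → Avoids (y ∷ v) →
  All (c ≢_) v → Rigid (R ++ c ∷ T) (y ∷ v) → All (c <_) (y ∷ v)
rigid-ascent R c T y [] _ c<y _ _ _ _ = c<y ∷ []
rigid-ascent R c T y (x ∷ v) (R<y ∷ R<x ∷ R≪v) c<y safeT (safey ∷ av) (c≢x ∷ c∉v) rigid with <-cmp x c
... | tri≈ _ x≡c _ = contradiction (sym x≡c) c≢x
... | tri> _ _ c<x = c<y ∷ rigid-ascent R c (proj₂ (rowIns y T)) x v (R<x ∷ R≪v) c<x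
  (rowIns-All y T safey (safe-tail safeT)) av c∉v
  (subst (λ X → Rigid X (x ∷ v))
    (trans (rowIns-++ (c ∷ T) (≪-≤ R<y)) (cong (R ++_) (rowIns-++ T (<⇒≤ c<y ∷ []))))
    (rigid-tail rigid))
... | tri< x<c _ _ = contradiction (bumped-swap T v (≪-≤ R<x) x<c x<y R′≤y) (rigid (x ∷ y ∷ v) (swap x<y))
  where
  x<y : x < y
  x<y = <-trans x<c c<y
  R′≤y : All (_≤ y) (R ++ c ∷ T)
  R′≤y = All.++⁺ (≪-≤ R<y) (<⇒≤ c<y ∷ All.map (λ safe → ≮⇒≥ λ y<z → <-asym x<y (All.head (AllPairs.head safe) y<z)) safeT)

bumped-peak : ∀ {R c e} v → R ≪ (c ∷ e ∷ v) → e < c → bumped R (c ∷ e ∷ v) ≡ c ∷ bumped (R ∷ʳ e) v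
bumped-peak {R} {c} {e} v (R<c ∷ R<e ∷ _) e<c = trans (bumped-append (e ∷ v) (≪-≤ R<c)) (bumped-bump {A = R} [] v (≪-≤ R<e) e<c)

bumped-valley : ∀ {R c e} v → R ≪ (c ∷ e ∷ v) → e < c → bumped R (e ∷ c ∷ v) ≡ bumped ((R ∷ʳ e) ∷ʳ c) v
bumped-valley {R} {c} {e} v (R<c ∷ R<e ∷ _) e<c = trans (bumped-append (c ∷ v) (≪-≤ R<e)) (bumped-append v (All.++⁺ (≪-≤ R<c) (<⇒≤ e<c ∷ [])))

-- After undoing the descent c e, an entry f < c would bump c again.
rigid-peak : ∀ {R c e f} v → R ≪ (c ∷ e ∷ f ∷ v) → e < c → e < f → Rigid R (c ∷ e ∷ f ∷ v) → ¬ (f < c)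
rigid-peak {R} {c} {e} {f} v R≪@(R<c ∷ R<e ∷ R<f ∷ _) e<c e<f rigid f<c = rigid (e ∷ c ∷ f ∷ v) (swap e<c) (begin
  bumped R (e ∷ c ∷ f ∷ v) ≡⟨ bumped-valley (f ∷ v) R≪ e<c ⟩
  bumped ((R ∷ʳ e) ∷ʳ c) (f ∷ v) ≡⟨ bumped-bump {A = R ∷ʳ e} [] v Re≤f f<c ⟩
  c ∷ bumped ((R ∷ʳ e) ∷ʳ f) v ≡⟨ cong (c ∷_) (bumped-append v Re≤f) ⟨
  c ∷ bumped (R ∷ʳ e) (f ∷ v) ≡⟨ bumped-peak (f ∷ v) R≪ e<c ⟨
  bumped R (c ∷ e ∷ f ∷ v) ∎)
  where
  open ≡-Reasoning
  Re≤f : All (_≤ f) (R ∷ʳ e)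
  Re≤f = All.++⁺ (≪-≤ R<f) (<⇒≤ e<f ∷ [])

-- The valley `e` of a block at the head of `v` decides: if `e` is below `c`, the block of `c`
-- continues; otherwise `c` lies below all of `v` and its block ends.
linked-sum : ∀ {c v} → All (c ≢_) v → Sum v → (∀ {f v′} → v ≡ f ∷ v′ → c < f) → Linked c v
linked-sum _ nil _ = close [] nil
linked-sum _ (fix f<v s) c< = close (c< refl ∷ All.map (<-trans (c< refl)) f<v) (fix f<v s)
linked-sum {c} (_ ∷ c≢e ∷ _) (block {e = e} e<f e<v l) c< with e <? c
... | yes e<c = link e<f e<c (c< refl) e<v l
... | no e≮c = close (c< refl ∷ c<e ∷ All.map (<-trans c<e) e<v) (block e<f e<v l)
  where
  c<e : c < e
  c<e = ≤∧≢⇒< (≮⇒≥ e≮c) c≢e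

-- An ascent at the start makes the first letter a `fix` by `rigid-ascent`; a descent starts a
-- block, and `rigid-peak` places the next letter above its peak. The recursion is on the length
-- bound `m`, as a block step consumes two letters.
rigid⇒sum : ∀ m R v → length v ≤ m → R ≪ v → Avoids v → Unique v → Rigid R v → Sum v
rigid⇒sum m R [] _ _ _ _ _ = nil
rigid⇒sum m R (c ∷ []) _ _ _ _ _ = fix [] nil
rigid⇒sum (suc m) R (c ∷ e ∷ v) (s≤s len) R≪@(R<c ∷ R<e ∷ R≪v) (safec ∷ ave@(_ ∷ av)) (c≢@(_ ∷ c≢v) ∷ ue@(_ ∷ uv)) rigid with <-cmp e c
... | tri≈ _ e≡c _ = contradiction (sym e≡c) (All.head c≢)
... | tri> _ _ c<e = fix c<ev (rigid⇒sum m (R ∷ʳ c) (e ∷ v) len (≪-∷ʳ (R<e ∷ R≪v) c<ev) ave ue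
        (subst (λ X → Rigid X (e ∷ v)) (cong proj₂ (rowIns-append (≪-≤ R<c))) (rigid-tail rigid)))
  where
  c<ev : All (c <_) (e ∷ v)
  c<ev = rigid-ascent R c [] e v (R<e ∷ R≪v) c<e [] ave c≢v
          (subst (λ X → Rigid X (e ∷ v)) (cong proj₂ (rowIns-append (≪-≤ R<c))) (rigid-tail rigid))
... | tri< e<c _ _ = block e<c e<v (linked-sum c≢v
        (rigid⇒sum m (R ∷ʳ e) v (<⇒≤ len) (≪-∷ʳ R≪v e<v) av uv rigid′) (c<head v e<v R≪ rigid c≢v))
  where
  e<v : All (e <_) v
  e<v = All.map (λ p → p e<c) (AllPairs.head safec)
  rigid′ : Rigid (R ∷ʳ e) v
  rigid′ v′ v′⋖v eq = rigid (c ∷ e ∷ v′) (skip (skip v′⋖v))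
    (trans (bumped-peak v′ (R<c ∷ R<e ∷ ⋖-All v′⋖v R≪v) e<c) (trans (cong (c ∷_) eq) (sym (bumped-peak v R≪ e<c))))
  c<head : ∀ v → All (e <_) v → R ≪ (c ∷ e ∷ v) → Rigid R (c ∷ e ∷ v) → All (c ≢_) v → ∀ {f v′} → v ≡ f ∷ v′ → c < f
  c<head (f ∷ v) (e<f ∷ _) R≪ rigid (c≢f ∷ _) refl = ≤∧≢⇒< (≮⇒≥ (rigid-peak v R≪ e<c e<f rigid)) c≢f

mutual
  peaks : ∀ {v} → Sum v → List ℕ
  peaks nil = []
  peaks (fix _ s) = peaks s
  peaks (block {c = c} _ _ l) = c ∷ peaksᴸ l
  peaksᴸ : ∀ {c v} → Linked c v → List ℕ
  peaksᴸ (close _ s) = peaks s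
  peaksᴸ (link {f = f} _ _ _ _ l) = f ∷ peaksᴸ l

mutual
  bumped-sum : ∀ {R v} (s : Sum v) → R ≪ v → bumped R v ≡ peaks s
  bumped-sum nil _ = refl
  bumped-sum (fix {v = v} c<v s) (R<c ∷ R≪v) = trans (bumped-append v (≪-≤ R<c)) (bumped-sum s (≪-∷ʳ R≪v c<v))
  bumped-sum (block {c} {v = v} e<c e<v l) R≪@(_ ∷ _ ∷ R≪v) = trans (bumped-peak v R≪ e<c) (cong (c ∷_) (bumped-linked l (≪-∷ʳ R≪v e<v)))
  bumped-linked : ∀ {R c v} (l : Linked c v) → R ≪ v → bumped R v ≡ peaksᴸ l
  bumped-linked (close _ s) R≪ = bumped-sum s R≪
  bumped-linked (link {f} {v = v} e<f _ _ e<v l) R≪@(_ ∷ _ ∷ R≪v) = trans (bumped-peak v R≪ e<f) (cong (f ∷_) (bumped-linked l (≪-∷ʳ R≪v e<v)))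

mutual
  -- Each peak is followed by its own smaller valley, so a peak at most `q` accounts for two letters
  -- at most `q`.
  peaks-dyck : ∀ {v} q (s : Sum v) → 2 * count (_≤? q) (peaks s) ≤ count (_≤? q) v
  peaks-dyck q nil = z≤n
  peaks-dyck q (fix {c} {v} _ s) = ≤-trans (peaks-dyck q s) (count-∷-≤ (_≤? q) c v)
  peaks-dyck q (block {c} {e} {v} e<c _ l) = count-peak c e q (peaksᴸ l) v e<c (peaksᴸ-dyck q l)
  peaksᴸ-dyck : ∀ {c v} q (l : Linked c v) → 2 * count (_≤? q) (peaksᴸ l) ≤ count (_≤? q) v
  peaksᴸ-dyck q (close _ s) = peaks-dyck q s
  peaksᴸ-dyck q (link {f} {e} {v} e<f _ _ _ l) = count-peak f e q (peaksᴸ l) v e<f (peaksᴸ-dyck q l)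
  count-peak : ∀ c e q L v → e < c → 2 * count (_≤? q) L ≤ count (_≤? q) v → 2 * count (_≤? q) (c ∷ L) ≤ count (_≤? q) (c ∷ e ∷ v)
  count-peak c e q L v e<c le with c ≤? q
  ... | no c≰q rewrite filter-reject (_≤? q) {c} {L} c≰q | filter-reject (_≤? q) {c} {e ∷ v} c≰q = ≤-trans le (count-∷-≤ (_≤? q) e v)
  ... | yes c≤q rewrite filter-accept (_≤? q) {c} {L} c≤q | filter-accept (_≤? q) {c} {e ∷ v} c≤q
    | filter-accept (_≤? q) {e} {v} (≤-trans (<⇒≤ e<c) c≤q) | *-suc 2 (count (_≤? q) L) = s≤s (s≤s le)

-- Alternating blocks

flat : (ℕ → ℕ) → (ℕ → ℕ) → ℕ → List ℕ
flat a b zero = []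
flat a b (suc m) = a 0 ∷ b 0 ∷ flat (a ∘ suc) (b ∘ suc) m

record Interlaced (a b : ℕ → ℕ) (k : ℕ) : Set where
  constructor interlaced
  field
    last : b k < a k
    step : ∀ i → i < k → b i < b (suc i) × b (suc i) < a i × a i < a (suc i)

module _ {a b k} (il : Interlaced a b k) where
  open Interlaced il

  b<a : ∀ i → i ≤ k → b i < a i
  b<a i i≤k with m≤n⇒m<n∨m≡n i≤k
  ... | inj₂ refl = last
  ... | inj₁ i<k = let b<b′ , b′<a , _ = step i i<k in <-trans b<b′ b′<a

  a-mono : ∀ {i j} → i ≤ j → j ≤ k → a i ≤ a j
  a-mono {i} i≤j = go (≤⇒≤′ i≤j)
    where
    go : ∀ {j} → i ≤′ j → j ≤ k → a i ≤ a j
    go ≤′-refl _ = ≤-refl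
    go (≤′-step {j} i≤′j) j<k = ≤-trans (go i≤′j (<⇒≤ j<k)) (<⇒≤ (proj₂ (proj₂ (step j j<k))))

  b-mono : ∀ {i j} → i ≤ j → j ≤ k → b i ≤ b j
  b-mono {i} i≤j = go (≤⇒≤′ i≤j)
    where
    go : ∀ {j} → i ≤′ j → j ≤ k → b i ≤ b j
    go ≤′-refl _ = ≤-refl
    go (≤′-step {j} i≤′j) j<k = ≤-trans (go i≤′j (<⇒≤ j<k)) (<⇒≤ (proj₁ (step j j<k)))

  a-strict : ∀ {i j} → i < j → j ≤ k → a i < a j
  a-strict {i} {j} i<j j≤k = <-≤-trans (proj₂ (proj₂ (step i (<-≤-trans i<j j≤k)))) (a-mono i<j j≤k)

  b-strict : ∀ {i j} → i < j → j ≤ k → b i < b j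
  b-strict {i} {j} i<j j≤k = <-≤-trans (proj₁ (step i (<-≤-trans i<j j≤k))) (b-mono i<j j≤k)

interlaced-tail : ∀ {a b k} → Interlaced a b (suc k) → Interlaced (a ∘ suc) (b ∘ suc) k
interlaced-tail (interlaced last step) = interlaced last (λ i i<k → step (suc i) (s≤s i<k))

flat-All : ∀ {Q : ℕ → Set} a b m → (∀ i → i < m → Q (a i) × Q (b i)) → All Q (flat a b m)
flat-All a b zero h = []
flat-All a b (suc m) h = proj₁ (h 0 z<s) ∷ proj₂ (h 0 z<s) ∷ flat-All (a ∘ suc) (b ∘ suc) m (λ i i<m → h (suc i) (s≤s i<m))

All-flat : ∀ {Q : ℕ → Set} a b m → All Q (flat a b m) → ∀ i → i < m → Q (a i) × Q (b i)
All-flat a b (suc m) (qa ∷ qb ∷ _) zero _ = qa , qb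
All-flat a b (suc m) (_ ∷ _ ∷ q) (suc i) (s≤s i<m) = All-flat (a ∘ suc) (b ∘ suc) m q i i<m

b₀< : ∀ {a b k G} → Interlaced a b k → All (a k <_) G → All (b 0 <_) (flat (a ∘ suc) (b ∘ suc) k ++ G)
b₀< {a} {b} {k} il a<G = All.++⁺
  (flat-All _ _ k (λ i i<k → let b< = b-strict il z<s i<k in <-trans b< (b<a il (suc i) i<k) , b<))
  (All.map (<-trans (≤-<-trans (b-mono il z≤n ≤-refl) (b<a il k ≤-refl))) a<G)

module _ {G g} (G-bumped : ∀ {R} → R ≪ G → bumped R G ≡ g) where

  -- Every peak is bumped at once by its own valley; the valleys stay in the row below all later
  -- letters.
  bumped-flat : ∀ {a b k R} → Interlaced a b k → All (a k <_) G → R ≪ (flat a b (suc k) ++ G) →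
    bumped R (flat a b (suc k) ++ G) ≡ applyUpTo a (suc k) ++ g
  bumped-flat {a} {k = zero} il a<G R≪@(_ ∷ _ ∷ R≪G) =
    trans (bumped-peak _ R≪ (b<a il 0 z≤n)) (cong (a 0 ∷_) (G-bumped (≪-∷ʳ R≪G (b₀< il a<G))))
  bumped-flat {a} {k = suc k} il a<G R≪@(_ ∷ _ ∷ R≪′) =
    trans (bumped-peak _ R≪ (b<a il 0 z≤n)) (cong (a 0 ∷_) (bumped-flat (interlaced-tail il) a<G (≪-∷ʳ R≪′ (b₀< il a<G))))

  -- The peak a₀ is bumped by b₁, so a₁ stays and is bumped by b₂, and so on: only a_k survives.
  bumped-shift : ∀ {a b k R} → Interlaced a b k → All (a k <_) G → R ≪ (flat a b (suc k) ++ G) →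
    bumped ((R ∷ʳ b 0) ∷ʳ a 0) (flat (a ∘ suc) (b ∘ suc) k ++ G) ≡ applyUpTo a k ++ g
  bumped-shift {k = zero} il a<G (_ ∷ _ ∷ R≪G) = G-bumped (≪-∷ʳ (≪-∷ʳ R≪G (b₀< il a<G)) a<G)
  bumped-shift {a} {b} {suc k} {R} il a<G (R<a ∷ R<b ∷ R≪′@(R<a₁ ∷ R<b₁ ∷ _)) = begin
    bumped ((R ∷ʳ b 0) ∷ʳ a 0) (a 1 ∷ b 1 ∷ rest) ≡⟨ bumped-append (b 1 ∷ rest) (All.++⁺ (All.++⁺ (≪-≤ R<a₁) (<⇒≤ (<-trans (b<a il 0 z≤n) a₀<a₁) ∷ [])) (<⇒≤ a₀<a₁ ∷ [])) ⟩
    bumped (((R ∷ʳ b 0) ∷ʳ a 0) ∷ʳ a 1) (b 1 ∷ rest) ≡⟨ cong (λ X → bumped X (b 1 ∷ rest)) (∷ʳ-++ (R ∷ʳ b 0) (a 0) (a 1 ∷ [])) ⟩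
    bumped ((R ∷ʳ b 0) ++ a 0 ∷ a 1 ∷ []) (b 1 ∷ rest) ≡⟨ bumped-bump {A = R ∷ʳ b 0} (a 1 ∷ []) rest (All.++⁺ (≪-≤ R<b₁) (<⇒≤ b₀<b₁ ∷ [])) b₁<a₀ ⟩
    a 0 ∷ bumped ((R ∷ʳ b 0) ++ b 1 ∷ a 1 ∷ []) rest ≡⟨ cong (λ X → a 0 ∷ bumped X rest) (∷ʳ-++ (R ∷ʳ b 0) (b 1) (a 1 ∷ [])) ⟨
    a 0 ∷ bumped (((R ∷ʳ b 0) ∷ʳ b 1) ∷ʳ a 1) rest ≡⟨ cong (a 0 ∷_) (bumped-shift (interlaced-tail il) a<G (≪-∷ʳ R≪′ (b₀< il a<G))) ⟩
    a 0 ∷ applyUpTo (a ∘ suc) k ++ g ∎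
    where
    open ≡-Reasoning
    rest = flat (λ i → a (2 + i)) (λ i → b (2 + i)) k ++ G
    b₀<b₁ = proj₁ (Interlaced.step il 0 z<s)
    b₁<a₀ = proj₁ (proj₂ (Interlaced.step il 0 z<s))
    a₀<a₁ = proj₂ (proj₂ (Interlaced.step il 0 z<s))

  -- The peaks before the undone descent leave as usual, and from there on `bumped-shift` applies.
  -- The result is the same for every descent: only the last peak is missing.
  bumped-swapped : ∀ {a b k R v} → Interlaced a b k → All (a k <_) G → AllPairs _<_ G → R ≪ (flat a b (suc k) ++ G) →
    v ⋖ (flat a b (suc k) ++ G) → bumped R v ≡ applyUpTo a k ++ g
  bumped-swapped il a<G _ R≪ (swap b<a) = trans (bumped-valley _ R≪ b<a) (bumped-shift il a<G R≪)
  bumped-swapped {k = zero} il a<G sG R≪ (skip (skip v⋖G)) = contradiction sG (⋖-unsorted v⋖G)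
    where
    ⋖-unsorted : ∀ {v w} → v ⋖ w → ¬ AllPairs _<_ w
    ⋖-unsorted (swap x<y) ((y<x ∷ _) ∷ _) = <-asym x<y y<x
    ⋖-unsorted (skip s) (_ ∷ sw) = ⋖-unsorted s sw
  bumped-swapped {a} {k = suc k} il a<G sG R≪@(R<a ∷ R<b ∷ R≪′) (skip (skip v⋖)) =
    trans (bumped-peak _ (R<a ∷ R<b ∷ ⋖-All v⋖ R≪′) (b<a il 0 z≤n))
      (cong (a 0 ∷_) (bumped-swapped (interlaced-tail il) a<G sG (≪-∷ʳ R≪′ (b₀< il a<G)) v⋖))
  bumped-swapped {k = zero} il a<G _ _ (skip (swap x<b)) = contradiction (All.head (b₀< il a<G)) (<-asym x<b)
  bumped-swapped {k = suc k} il a<G _ _ (skip (swap x<b)) = contradiction (All.head (b₀< il a<G)) (<-asym x<b)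

-- Splitting off and shortening blocks

cons : ℕ → (ℕ → ℕ) → ℕ → ℕ
cons x f zero = x
cons x f (suc i) = f i

-- The block starting with `c` `e`, turned from `Linked` into indexed form, and the direct sum `G`
-- after it. The first values are fixed by equations so that `opening` can prepend with `cons`.
record Opening (c e : ℕ) (v : List ℕ) : Set where
  field
    a b : ℕ → ℕ
    k : ℕ
    G : List ℕ
    a₀ : a 0 ≡ c
    b₀ : b 0 ≡ e
    word : v ≡ flat (a ∘ suc) (b ∘ suc) k ++ G
    interl : Interlaced a b k
    above : All (a k <_) G
    rest : Sum G

opening : ∀ {c e v} → e < c → All (e <_) v → Linked c v → Opening c e v
opening {c} {e} {v} e<c _ (close c<v s) = record
  { a = λ _ → c ; b = λ _ → e ; k = 0 ; G = v ; a₀ = refl ; b₀ = refl ; word = refl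
  ; interl = interlaced e<c (λ _ ()) ; above = c<v ; rest = s }
opening {c} {e} e<c (_ ∷ e<e′ ∷ _) (link {f} {e′} e′<f e′<c c<f e′<v l) = record
  { a = cons c a ; b = cons e b ; k = suc k ; G = G ; a₀ = refl ; b₀ = refl
  ; word = cong₂ _∷_ (sym a₀) (cong₂ _∷_ (sym b₀) word)
  ; interl = interlaced (Interlaced.last interl) λ where
      zero _ → subst (e <_) (sym b₀) e<e′ , subst (_< c) (sym b₀) e′<c , subst (c <_) (sym a₀) c<f
      (suc i) (s≤s i<k) → Interlaced.step interl i i<k
  ; above = above ; rest = rest }
  where open Opening (opening e′<f e′<v l)

-- A descent whose undoing removes the single entry `m` from the bumped sequence `L`. Applied to
-- what follows the first block, it yields a smaller word that leaves this block intact.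
record Shortening (v L : List ℕ) : Set where
  field
    v′ S T : List ℕ
    m : ℕ
    below : v′ ⋖ v
    split : L ≡ S ++ m ∷ T
    bumps : ∀ {R} → R ≪ v → bumped R v′ ≡ S ++ T

-- The last descent of the block is undone: only letters above its peak follow, so this peak is
-- never bumped.
shorten-block : ∀ {c e v} (e<c : e < c) (e<v : All (e <_) v) (l : Linked c v) → Shortening (c ∷ e ∷ v) (c ∷ peaksᴸ l)
shorten-block {c} {e} {v} e<c e<v (close c<v s) = record
  { v′ = e ∷ c ∷ v ; S = [] ; T = peaks s ; m = c ; below = swap e<c ; split = refl
  ; bumps = λ where R≪@(_ ∷ _ ∷ R≪v) → trans (bumped-valley v R≪ e<c) (bumped-sum s (≪-∷ʳ (≪-∷ʳ R≪v e<v) c<v)) }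
shorten-block {c} {e} e<c e<v (link e′<f _ _ e′<v l) = record
  { v′ = c ∷ e ∷ v′ ; S = c ∷ S ; T = T ; m = m ; below = skip (skip below) ; split = cong (c ∷_) split
  ; bumps = λ where (R<c ∷ R<e ∷ R≪v) → trans (bumped-peak v′ (R<c ∷ R<e ∷ ⋖-All below R≪v) e<c) (cong (c ∷_) (bumps (≪-∷ʳ R≪v e<v))) }
  where open Shortening (shorten-block e′<f e′<v l)

sorted-or-shorten : ∀ {v} (s : Sum v) → (AllPairs _<_ v × peaks s ≡ []) ⊎ Shortening v (peaks s)
sorted-or-shorten nil = inj₁ ([] , refl)
sorted-or-shorten (fix {c} c<v s) with sorted-or-shorten s
... | inj₁ (sv , eq) = inj₁ (c<v ∷ sv , eq)
... | inj₂ sh = inj₂ (record { v′ = c ∷ v′ ; S = S ; T = T ; m = m ; below = skip below ; split = split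
  ; bumps = λ where (R<c ∷ R≪v) → trans (bumped-append v′ (≪-≤ R<c)) (bumps (≪-∷ʳ R≪v c<v)) })
  where open Shortening sh
sorted-or-shorten (block e<c e<v l) = inj₂ (shorten-block e<c e<v l)

-- Counting peaks in windows

count-none : ∀ {Q : Pred ℕ 0ℓ} (Q? : Decidable Q) {L} → All (λ e → ¬ Q e) L → count Q? L ≡ 0
count-none Q? ¬Q = cong length (filter-none Q? ¬Q)

count-∪ : ∀ {Q Q₁ Q₂ : Pred ℕ 0ℓ} (Q? : Decidable Q) (Q₁? : Decidable Q₁) (Q₂? : Decidable Q₂) →
  (∀ {e} → Q e → Q₁ e ⊎ Q₂ e) → ∀ L → count Q? L ≤ count Q₁? L + count Q₂? L
count-∪ Q? Q₁? Q₂? sub [] = z≤n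
count-∪ Q? Q₁? Q₂? sub (x ∷ L) with Q? x
... | no _ = ≤-trans (count-∪ Q? Q₁? Q₂? sub L) (+-mono-≤ (count-∷-≤ Q₁? x L) (count-∷-≤ Q₂? x L))
... | yes q with sub q
...   | inj₁ q₁ rewrite filter-accept Q₁? {x} {L} q₁ = s≤s (≤-trans (count-∪ Q? Q₁? Q₂? sub L) (+-monoʳ-≤ (count Q₁? L) (count-∷-≤ Q₂? x L)))
...   | inj₂ q₂ rewrite filter-accept Q₂? {x} {L} q₂ | +-suc (count Q₁? (x ∷ L)) (count Q₂? L) =
  s≤s (≤-trans (count-∪ Q? Q₁? Q₂? sub L) (+-monoˡ-≤ (count Q₂? L) (count-∷-≤ Q₁? x L)))

count-≟ : ∀ t {L} → Unique L → count (_≟ t) L ≤ 1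
count-≟ t [] = z≤n
count-≟ t {x ∷ L} (x≢ ∷ uL) with x ≟ t
... | yes refl rewrite filter-accept (_≟ t) {t} {L} refl = s≤s (≤-reflexive (count-none (_≟ t) (All.map (_∘ sym) x≢)))
... | no x≢t rewrite filter-reject (_≟ t) {x} {L} x≢t = count-≟ t uL

unique-count : ∀ c m {L} → Unique L → count (in? (suc c) (c + m)) L ≤ m
unique-count c zero {L} uL = ≤-reflexive (count-none (in? (suc c) (c + 0)) {L}
  (All.universal (λ _ (c<e , e≤c) → <⇒≱ c<e (≤-trans e≤c (≤-reflexive (+-identityʳ c)))) L))
unique-count c (suc m) {L} uL = begin
  count (in? (suc c) (c + suc m)) L ≤⟨ count-∪ (in? (suc c) (c + suc m)) (in? (suc c) (c + m)) (_≟ c + suc m) split L ⟩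
  count (in? (suc c) (c + m)) L + count (_≟ c + suc m) L ≤⟨ +-mono-≤ (unique-count c m uL) (count-≟ (c + suc m) uL) ⟩
  m + 1 ≡⟨ +-comm m 1 ⟩
  suc m ∎
  where
  open ≤-Reasoning
  split : ∀ {e} → In (suc c) (c + suc m) e → In (suc c) (c + m) e ⊎ e ≡ c + suc m
  split {e} (c<e , e≤) with m≤n⇒m<n∨m≡n e≤
  ... | inj₂ e≡ = inj₂ e≡
  ... | inj₁ e< = inj₁ (c<e , ≤-pred (≤-trans e< (≤-reflexive (+-suc c m))))

peaks-count : ∀ {c q G} → Unique G → All (c <_) G → c ≤ q → (s : Sum G) → 2 * count (_≤? q) (peaks s) ≤ q ∸ c
peaks-count {c} {q} {G} uG c<G c≤q s = begin
  2 * count (_≤? q) (peaks s) ≤⟨ peaks-dyck q s ⟩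
  count (_≤? q) G ≤⟨ count-⊆ᴬ (_≤? q) (in? (suc c) (c + (q ∸ c))) (All.map (λ c<e e≤q → c<e , ≤-trans e≤q (≤-reflexive (sym (m+[n∸m]≡n c≤q)))) c<G) ⟩
  count (in? (suc c) (c + (q ∸ c))) G ≤⟨ unique-count c (q ∸ c) uG ⟩
  q ∸ c ∎
  where open ≤-Reasoning

-- By peaks-count at most half of the values in a window above c are peaks, so
-- cutting the window off at c keeps it crowded.
crowded-below : ∀ {T c G S} U → Unique G → All (c <_) G → (s : Sum G) → peaks s ≡ S → All (_< c) T →
  Crowded (T ++ c ∷ S) → ¬ Crowded (T ++ S) → Crowded (T ++ c ∷ U)
crowded-below {T} {c} {G} {S} U uG c<G s refl T<c cr ¬cr with crowded⇒window (T ++ c ∷ S) cr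
... | p , x , 0<x , lt with in? p (p + 2 * x) c
-- A window that misses `c` contains as many entries of `T ++ S`.
...   | no c∉ = contradiction (window⇒crowded (T ++ S) p x 0<x (subst (suc x <_) drop-c lt)) ¬cr
  where
  drop-c : count (in? p (p + 2 * x)) (T ++ c ∷ S) ≡ count (in? p (p + 2 * x)) (T ++ S)
  drop-c = trans (count-++ (in? p (p + 2 * x)) T (c ∷ S)) (trans
    (cong (λ L → count (in? p (p + 2 * x)) T + length L) (filter-reject (in? p (p + 2 * x)) {c} {S} c∉))
    (sym (count-++ (in? p (p + 2 * x)) T S)))
-- The new window starts at `p` as well and has the least even length that reaches `c`; rounding may
-- carry it one step past `c`.
...   | yes (p≤c , c≤q) = window⇒crowded (T ++ c ∷ U) p ⌈ r /2⌉ (0<⌈⌉ r 0<r) (begin-strict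
  suc ⌈ r /2⌉ <⟨ half r N big ⟩
  N ≤⟨ s≤s (count-⊆ᴬ Q? Q′? (All.map (λ e<c (p≤e , _) → p≤e , ≤-trans (<⇒≤ e<c) c≤q′) T<c)) ⟩
  suc (count Q′? T) ≤⟨ s≤s (m≤m+n _ (count Q′? U)) ⟩
  suc (count Q′? T + count Q′? U) ≡⟨ +-suc (count Q′? T) (count Q′? U) ⟨
  count Q′? T + suc (count Q′? U) ≡⟨ cong (λ L → count Q′? T + length L) (filter-accept Q′? {c} {U} (p≤c , c≤q′)) ⟨
  count Q′? T + count Q′? (c ∷ U) ≡⟨ count-++ Q′? T (c ∷ U) ⟨
  count Q′? (T ++ c ∷ U) ∎)
  where
  open ≤-Reasoning
  q = p + 2 * x
  r = c ∸ p
  Q? = in? p q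
  Q′? = in? p (p + 2 * ⌈ r /2⌉)
  N = suc (count Q? T)
  0<⌈⌉ : ∀ r → 0 < r → 0 < ⌈ r /2⌉
  0<⌈⌉ (suc zero) _ = z<s
  0<⌈⌉ (suc (suc r)) _ = z<s
  r≤2⌈r/2⌉ : ∀ r → r ≤ 2 * ⌈ r /2⌉
  r≤2⌈r/2⌉ zero = z≤n
  r≤2⌈r/2⌉ (suc zero) = s≤s z≤n
  r≤2⌈r/2⌉ (suc (suc r)) rewrite *-suc 2 ⌈ r /2⌉ = s≤s (s≤s (r≤2⌈r/2⌉ r))
  half : ∀ r N → 4 + r ≤ 2 * N → suc ⌈ r /2⌉ < N
  half r zero ()
  half r (suc zero) (s≤s (s≤s ()))
  half zero (suc (suc N)) _ = s≤s (s≤s z≤n)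
  half (suc zero) (suc (suc zero)) (s≤s (s≤s (s≤s (s≤s ()))))
  half (suc zero) (suc (suc (suc N))) _ = s≤s (s≤s (s≤s z≤n))
  half (suc (suc r)) (suc N) le rewrite *-suc 2 N = s≤s (half r N (≤-pred (≤-pred le)))
  c≤q′ : c ≤ p + 2 * ⌈ r /2⌉
  c≤q′ = ≤-trans (≤-reflexive (sym (m+[n∸m]≡n p≤c))) (+-monoʳ-≤ p (r≤2⌈r/2⌉ r))
  S-few : 2 * count Q? S ≤ q ∸ c
  S-few = ≤-trans (*-monoʳ-≤ 2 (count-⊆ Q? (_≤? q) proj₂ S)) (peaks-count uG c<G c≤q s)
  total : suc x < N + count Q? S
  total = subst (suc x <_) (trans (count-++ Q? T (c ∷ S)) (trans
    (cong (λ L → count Q? T + length L) (filter-accept Q? {c} {S} (p≤c , c≤q))) (+-suc (count Q? T) (count Q? S)))) lt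
  rt : r + (q ∸ c) ≡ 2 * x
  rt = +-cancelˡ-≡ p _ _ (trans (sym (+-assoc p r (q ∸ c))) (trans (cong (_+ (q ∸ c)) (m+[n∸m]≡n p≤c)) (m+[n∸m]≡n c≤q)))
  -- `N` counts `c` and the entries of `T` in the old window. Its length `2 * x` splits at `c` into
  -- `r` and `q ∸ c`, and the second part pays for twice the number of entries of `S` in it.
  big : 4 + r ≤ 2 * N
  big = +-cancelʳ-≤ (q ∸ c) _ _ (begin
    4 + r + (q ∸ c) ≡⟨ cong (4 +_) rt ⟩
    4 + 2 * x ≡⟨ *-distribˡ-+ 2 2 x ⟨
    2 * (2 + x) ≤⟨ *-monoʳ-≤ 2 total ⟩
    2 * (N + count Q? S) ≡⟨ *-distribˡ-+ 2 N (count Q? S) ⟩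
    2 * N + 2 * count Q? S ≤⟨ +-monoʳ-≤ (2 * N) S-few ⟩
    2 * N + (q ∸ c) ∎)
  -- A crowded window needs positive length. If it started at `c`, no entry of `T` would be in it,
  -- so `N` would be 1, against `big`.
  0<r : 0 < r
  0<r with r in r≡
  ... | suc _ = z<s
  ... | zero = contradiction (subst (λ n → 4 ≤ 2 * suc n) T-none (≤-trans (m≤m+n 4 r) big)) λ where (s≤s (s≤s ()))
    where
    T-none : count Q? T ≡ 0
    T-none = count-none Q? (All.map (λ e<c (p≤e , _) → <⇒≱ e<c (≤-trans (m∸n≡0⇒m≤n r≡) p≤e)) T<c)

-- Reduction to a single block

unique-++⁻ʳ : ∀ u {v : List ℕ} → Unique (u ++ v) → Unique v
unique-++⁻ʳ [] uv = uv
unique-++⁻ʳ (_ ∷ u) (_ ∷ uv) = unique-++⁻ʳ u uv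

-- `crowded` and `uncrowded` together express local minimality: the bumped entries are the peaks of
-- the one block, and undoing any descent drops the last of them.
record Normal (v : List ℕ) : Set where
  field
    F G : List ℕ
    a b : ℕ → ℕ
    k : ℕ
    word : v ≡ F ++ flat a b (suc k) ++ G
    F-sorted : AllPairs _<_ F
    F≪ : F ≪ (flat a b (suc k) ++ G)
    interl : Interlaced a b k
    above : All (a k <_) G
    G-sorted : AllPairs _<_ G
    crowded : Crowded (applyUpTo a (suc k))
    uncrowded : ¬ Crowded (applyUpTo a k)

sum⇒normal : ∀ {R v} → Sum v → R ≪ v → Unique v → Crowded (bumped R v) → (∀ v′ → v′ ⋖ v → ¬ Crowded (bumped R v′)) → Normal v
sum⇒normal nil _ _ (_ , _ , _ , ()) _
sum⇒normal {R} (fix {c} {v} c<v s) (R<c ∷ R≪v) (_ ∷ uv) cr ¬cr = record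
  { F = c ∷ F ; G = G ; a = a ; b = b ; k = k ; word = cong (c ∷_) word
  ; F-sorted = All.++⁻ˡ F c<v′ ∷ F-sorted
  ; F≪ = All.zipWith (λ (p , q) → p ∷ q) (All.++⁻ʳ F c<v′ , F≪)
  ; interl = interl ; above = above ; G-sorted = G-sorted ; crowded = crowded ; uncrowded = uncrowded }
  where
  open Normal (sum⇒normal s (≪-∷ʳ R≪v c<v) uv (subst Crowded (bumped-append v (≪-≤ R<c)) cr)
    (λ v′ v′⋖v → ¬cr (c ∷ v′) (skip v′⋖v) ∘ subst Crowded (sym (bumped-append v′ (≪-≤ R<c)))))
  c<v′ : All (c <_) (F ++ flat a b (suc k) ++ G)
  c<v′ = subst (All (c <_)) word c<v
sum⇒normal {R} (block {c} {e} {v} e<c e<v l) R≪ (_ ∷ _ ∷ uv) cr ¬cr = finish (opening e<c e<v l)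
  where
  finish : Opening c e v → Normal (c ∷ e ∷ v)
  finish record { a = a ; b = b ; k = k ; G = G ; a₀ = refl ; b₀ = refl ; word = refl ; interl = il ; above = a<G ; rest = s }
    with sorted-or-shorten s
  ... | inj₁ (sG , no-peaks) = record
    { F = [] ; G = G ; a = a ; b = b ; k = k ; word = refl ; F-sorted = []
    ; F≪ = All.universal (λ _ → []) _ ; interl = il ; above = a<G ; G-sorted = sG
    ; crowded = subst Crowded (trans (bumped-flat G-bumped il a<G R≪) (++-identityʳ _)) cr
    ; uncrowded = ¬cr _ (swap e<c) ∘ subst Crowded (sym (trans (bumped-valley _ R≪ e<c) (trans (bumped-shift G-bumped il a<G R≪) (++-identityʳ _)))) }
    where
    G-bumped : ∀ {R} → R ≪ G → bumped R G ≡ []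
    G-bumped R≪G = trans (bumped-sum s R≪G) no-peaks
  -- There is a second block. Undoing the first descent drops `a k` and must destroy crowdedness, so
  -- `crowded-below` applies: the peaks of the first block followed by any further entries are
  -- crowded. Hence shortening a later block leaves a crowded word below.
  ... | inj₂ sh = contradiction
    (crowded-below {applyUpTo a k} {a k} (S ++ T)
      (unique-++⁻ʳ (flat (a ∘ suc) (b ∘ suc) k) uv) a<G s refl
      (All.applyUpTo⁺₁ a k λ i<k → a-strict il i<k ≤-refl)
      (subst Crowded (trans (bumped-flat (bumped-sum s) il a<G R≪) (last-peak (peaks s))) cr)
      (¬cr _ (swap e<c) ∘ subst Crowded (sym (trans (bumped-valley _ R≪ e<c) (bumped-shift (bumped-sum s) il a<G R≪)))))
    (¬cr _ (⋖-++ (flat a b (suc k)) below) ∘ subst Crowded (sym (trans (bumped-flat (bumps ∘ ⋖-All⁻ below) il (⋖-All below a<G) (⋖-All (⋖-++ (flat a b (suc k)) below) R≪)) (last-peak (S ++ T)))))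
    where
    open Shortening sh
    last-peak : ∀ L → applyUpTo a (suc k) ++ L ≡ applyUpTo a k ++ a k ∷ L
    last-peak L = trans (cong (_++ L) (sym (applyUpTo-∷ʳ a k))) (∷ʳ-++ (applyUpTo a k) (a k) L)

-- Ranks of entries of permutations

interval : ℕ → ℕ → List ℕ
interval m zero = []
interval m (suc l) = m ∷ interval (suc m) l

interval-++ : ∀ m l₁ l₂ → interval m (l₁ + l₂) ≡ interval m l₁ ++ interval (m + l₁) l₂
interval-++ m zero l₂ rewrite +-identityʳ m = refl
interval-++ m (suc l₁) l₂ rewrite +-suc m l₁ = cong (m ∷_) (interval-++ (suc m) l₁ l₂)

length-interval : ∀ m l → length (interval m l) ≡ l
length-interval m zero = refl
length-interval m (suc l) = cong suc (length-interval (suc m) l)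

interval-≥ : ∀ m l → All (m ≤_) (interval m l)
interval-≥ m zero = []
interval-≥ m (suc l) = ≤-refl ∷ All.map <⇒≤ (interval-≥ (suc m) l)

interval-< : ∀ m l → All (_< m + l) (interval m l)
interval-< m zero = []
interval-< m (suc l) rewrite +-suc m l = s≤s (m≤m+n m l) ∷ interval-< (suc m) l

interval-sorted : ∀ m l → AllPairs _<_ (interval m l)
interval-sorted m zero = []
interval-sorted m (suc l) = interval-≥ (suc m) l ∷ interval-sorted (suc m) l

upTo-interval : ∀ n → map suc (upTo n) ≡ interval 1 n
upTo-interval n = trans (map-upTo suc n) (go suc 1 n (λ _ → refl))
  where
  go : ∀ f m n → (∀ i → f i ≡ m + i) → applyUpTo f n ≡ interval m n
  go f m zero h = refl
  go f m (suc n) h = cong₂ _∷_ (trans (h 0) (+-identityʳ m)) (go (f ∘ suc) (suc m) n (λ i → trans (h (suc i)) (+-suc m i)))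

count-interval : ∀ {x} m l → m ≤ x → x ≤ m + l → count (_<? x) (interval m l) ≡ x ∸ m
count-interval {x} m zero m≤x x≤m rewrite +-identityʳ m = sym (m≤n⇒m∸n≡0 x≤m)
count-interval {x} m (suc l) m≤x x≤m+l with m≤n⇒m<n∨m≡n m≤x
... | inj₁ m<x = begin
  count (_<? x) (interval m (suc l)) ≡⟨ cong length (filter-accept (_<? x) m<x) ⟩
  suc (count (_<? x) (interval (suc m) l)) ≡⟨ cong suc (count-interval (suc m) l m<x (subst (x ≤_) (+-suc m l) x≤m+l)) ⟩
  suc (x ∸ suc m) ≡⟨ +-∸-assoc 1 m<x ⟨
  x ∸ m ∎
  where open ≡-Reasoning
... | inj₂ refl = trans (count-none (_<? x) (All.map ≤⇒≯ (interval-≥ m (suc l)))) (sym (n∸n≡0 m))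

perm-interval : ∀ {n w} → IsPerm n w → w ↭ interval 1 n
perm-interval {n} perm rewrite sym (upTo-interval n) = perm

-- The number of entries below `x` is the same as in the identity word, where it is `x ∸ 1`.
rank : ∀ {n w x} → IsPerm n w → x ∈ w → x ≡ suc (count (_<? x) w)
rank {n} {w} {x} perm x∈w = begin
  x ≡⟨ m+[n∸m]≡n (proj₁ bounds) ⟨
  suc (x ∸ 1) ≡⟨ cong suc (count-interval 1 n (proj₁ bounds) (<⇒≤ (proj₂ bounds))) ⟨
  suc (count (_<? x) (interval 1 n)) ≡⟨ cong suc (count-↭ (_<? x) (perm-interval perm)) ⟨
  suc (count (_<? x) w) ∎
  where
  open ≡-Reasoning
  bounds : 1 ≤ x × x < suc n
  bounds = All.lookup (All-resp-↭ (↭-sym (perm-interval perm)) (All.zip (interval-≥ 1 n , interval-< 1 n))) x∈w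

count-all : ∀ {Q : Pred ℕ 0ℓ} (Q? : Decidable Q) {L} → All Q L → count Q? L ≡ length L
count-all Q? q = cong length (filter-all Q? q)

length-∷ʳ : ∀ (u : List ℕ) x → length (u ∷ʳ x) ≡ suc (length u)
length-∷ʳ u x = trans (length-++ u) (+-comm (length u) 1)

-- For each entry of `H` the smaller entries are exactly those to its left, so `rank` makes its
-- value equal to its position.
sorted-segment : ∀ {n w} u H v → IsPerm n w → w ≡ u ++ H ++ v → u ≪ H → AllPairs _<_ H → H ≪ v →
  H ≡ interval (suc (length u)) (length H)
sorted-segment u [] v perm word _ _ _ = refl
sorted-segment {n} u (x ∷ H) v perm refl (u<x ∷ u≪H) (x<H ∷ sH) H≪v = cong₂ _∷_ x≡
  (trans (sorted-segment (u ∷ʳ x) H v perm (sym (∷ʳ-++ u x (H ++ v))) (≪-∷ʳ u≪H x<H) sH (All.map All.tail H≪v))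
    (cong (λ m → interval (suc m) (length H)) (length-∷ʳ u x)))
  where
  open ≡-Reasoning
  x≡ : x ≡ suc (length u)
  x≡ = begin
    x ≡⟨ rank perm (∈-++⁺ʳ u (here refl)) ⟩
    suc (count (_<? x) (u ++ x ∷ H ++ v)) ≡⟨ cong suc (count-++ (_<? x) u (x ∷ H ++ v)) ⟩
    suc (count (_<? x) u + count (_<? x) (x ∷ H ++ v)) ≡⟨ cong suc (cong₂ _+_ (count-all (_<? x) u<x)
       (count-none (_<? x) (<-irrefl refl ∷ All.map <-asym (All.++⁺ x<H (All.map All.head H≪v))))) ⟩
    suc (length u + 0) ≡⟨ cong suc (+-identityʳ (length u)) ⟩
    suc (length u) ∎

↭-cancelˡ : ∀ (u : List ℕ) {v w} → u ++ v ↭ u ++ w → v ↭ w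
↭-cancelˡ [] p = p
↭-cancelˡ (x ∷ u) p = ↭-cancelˡ u (drop-∷ p)

-- Single-block permutations

-- Here d is the number of fixed points before the block, so that the first
-- descent is at position d + 1.
blockWord : ℕ → ℕ → ℕ → (ℕ → ℕ) → (ℕ → ℕ) → List ℕ
blockWord d k r a b = interval 1 d ++ flat a b (suc k) ++ interval (suc (d + 2 * suc k)) r

length-flat : ∀ a b m → length (flat a b m) ≡ 2 * m
length-flat a b zero = refl
length-flat a b (suc m) rewrite *-suc 2 m = cong (2 +_) (length-flat (a ∘ suc) (b ∘ suc) m)

length-blockWord : ∀ d k r a b → length (blockWord d k r a b) ≡ d + 2 * suc k + r
length-blockWord d k r a b = begin
  length (blockWord d k r a b) ≡⟨ length-++ (interval 1 d) ⟩
  length (interval 1 d) + length (flat a b (suc k) ++ interval (suc (d + 2 * suc k)) r) ≡⟨ cong₂ _+_ (length-interval 1 d) (length-++ (flat a b (suc k))) ⟩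
  d + (length (flat a b (suc k)) + length (interval (suc (d + 2 * suc k)) r)) ≡⟨ cong (d +_) (cong₂ _+_ (length-flat a b (suc k)) (length-interval _ r)) ⟩
  d + (2 * suc k + r) ≡⟨ +-assoc d _ r ⟨
  d + 2 * suc k + r ∎
  where open ≡-Reasoning

flat≪ : ∀ {a b k G} → Interlaced a b k → All (a k <_) G → flat a b (suc k) ≪ G
flat≪ {a} {b} {k} il = All.map λ a<x → flat-All a b (suc k) λ where
  i (s≤s i≤k) → ≤-<-trans (a-mono il i≤k ≤-refl) a<x , <-trans (b<a il i i≤k) (≤-<-trans (a-mono il i≤k ≤-refl) a<x)

normal⇒blockWord : ∀ {n w} → IsPerm n w → (nf : Normal w) →
  w ≡ blockWord (length (Normal.F nf)) (Normal.k nf) (length (Normal.G nf)) (Normal.a nf) (Normal.b nf)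
normal⇒blockWord {n} {w} perm nf = trans word (cong₂ (λ X Y → X ++ flat a b (suc k) ++ Y)
  (sorted-segment [] F (flat a b (suc k) ++ G) perm word (All.universal (λ _ → []) F) F-sorted F≪)
  (trans (sorted-segment (F ++ flat a b (suc k)) G [] perm
      (trans word (trans (sym (++-assoc F (flat a b (suc k)) G)) (cong ((F ++ flat a b (suc k)) ++_) (sym (++-identityʳ G)))))
      (All.zipWith (λ (p , q) → All.++⁺ p q) (All.++⁻ʳ (flat a b (suc k)) F≪ , flat≪ interl above)) G-sorted [])
    (cong (λ m → interval (suc m) (length G)) (trans (length-++ F) (cong (length F +_) (length-flat a b (suc k)))))))
  where open Normal nf

-- Positions in single-block permutations

at-++ˡ : ∀ u v {i} → i < length u → at (u ++ v) (suc i) ≡ at u (suc i)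
at-++ˡ (x ∷ u) v {zero} _ = refl
at-++ˡ (x ∷ u) v {suc i} (s≤s i<) = at-++ˡ u v i<

at-++ʳ : ∀ u v i → at (u ++ v) (suc (length u + i)) ≡ at v (suc i)
at-++ʳ [] v i = refl
at-++ʳ (x ∷ u) v i = at-++ʳ u v i

at-interval : ∀ m l {i} → i < l → at (interval m l) (suc i) ≡ m + i
at-interval m (suc l) {zero} _ = sym (+-identityʳ m)
at-interval m (suc l) {suc i} (s≤s i<) = trans (at-interval (suc m) l i<) (sym (+-suc m i))

at-flat : ∀ a b {m} G {i} → i < m → at (flat a b m ++ G) (suc (2 * i)) ≡ a i × at (flat a b m ++ G) (suc (suc (2 * i))) ≡ b i
at-flat a b {suc m} G {zero} _ = refl , refl
at-flat a b {suc m} G {suc i} (s≤s i<) rewrite *-suc 2 i = at-flat (a ∘ suc) (b ∘ suc) G i<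

at-ext : ∀ u v → length u ≡ length v → (∀ i → i < length u → at u (suc i) ≡ at v (suc i)) → u ≡ v
at-ext [] [] _ _ = refl
at-ext (x ∷ u) (y ∷ v) len h = cong₂ _∷_ (h 0 z<s) (at-ext u v (suc-injective len) (λ i i< → h (suc i) (s≤s i<)))

halve : ∀ e → ∃[ h ] (e ≡ 2 * h ⊎ e ≡ suc (2 * h))
halve zero = 0 , inj₁ refl
halve (suc e) with halve e
... | h , inj₁ eq = h , inj₂ (cong suc eq)
... | h , inj₂ eq = suc h , inj₁ (trans (cong suc eq) (sym (*-suc 2 h)))

module _ (d k r : ℕ) (a b : ℕ → ℕ) where

  private
    W = blockWord d k r a b
    top = d + 2 * suc k

  at-low : ∀ {i} → i < d → at W (suc i) ≡ suc i
  at-low i<d = trans (at-++ˡ (interval 1 d) _ (subst (_ <_) (sym (length-interval 1 d)) i<d)) (at-interval 1 d i<d)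

  at-middle : ∀ i → at W (suc (d + i)) ≡ at (flat a b (suc k) ++ interval (suc top) r) (suc i)
  at-middle i = subst (λ l → at W (suc (l + i)) ≡ at (flat a b (suc k) ++ interval (suc top) r) (suc i)) (length-interval 1 d) (at-++ʳ (interval 1 d) _ i)

  at-peak : ∀ {i} → i ≤ k → at W (suc d + 2 * i) ≡ a i
  at-peak {i} i≤k = trans (at-middle (2 * i)) (proj₁ (at-flat a b _ (s≤s i≤k)))

  at-valley : ∀ {i} → i ≤ k → at W (suc (suc d + 2 * i)) ≡ b i
  at-valley {i} i≤k = trans (cong (at W ∘ suc) (sym (+-suc d (2 * i)))) (trans (at-middle (suc (2 * i))) (proj₂ (at-flat a b _ (s≤s i≤k))))

  at-high : ∀ {j} → top < j → j ≤ top + r → at W j ≡ j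
  at-high {j} top<j j≤n = begin
    at W j ≡⟨ cong (at W) j≡ ⟩
    at W (suc (d + (2 * suc k + e))) ≡⟨ at-middle (2 * suc k + e) ⟩
    at (flat a b (suc k) ++ interval (suc top) r) (suc (2 * suc k + e)) ≡⟨ cong (λ l → at (flat a b (suc k) ++ interval (suc top) r) (suc (l + e))) (length-flat a b (suc k)) ⟨
    at (flat a b (suc k) ++ interval (suc top) r) (suc (length (flat a b (suc k)) + e)) ≡⟨ at-++ʳ (flat a b (suc k)) _ e ⟩
    at (interval (suc top) r) (suc e) ≡⟨ at-interval (suc top) r (+-cancelˡ-< top _ _ (<-≤-trans (≤-reflexive (m+[n∸m]≡n top<j)) j≤n)) ⟩
    suc top + e ≡⟨ m+[n∸m]≡n top<j ⟩
    j ∎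
    where
    open ≡-Reasoning
    e = j ∸ suc top
    j≡ : j ≡ suc (d + (2 * suc k + e))
    j≡ = trans (sym (m+[n∸m]≡n top<j)) (cong suc (+-assoc d (2 * suc k) e))

  -- The block begins at position `suc d`, with peaks at even and valleys at odd distance from
  -- there. `high` carries no upper bound, which makes `place` total; the bound is supplied when a
  -- value is read.
  data Place : ℕ → Set where
    low : ∀ {i} → i < d → Place (suc i)
    peak : ∀ {i} → i ≤ k → Place (suc d + 2 * i)
    valley : ∀ {i} → i ≤ k → Place (suc (suc d + 2 * i))
    high : ∀ {j} → top < j → Place j

  place : ∀ i → Place (suc i)
  place i with i <? d
  ... | yes i<d = low i<d
  ... | no i≮d with halve (i ∸ d)
  ...   | h , eq with h ≤? k
  place i | no i≮d | h , inj₁ eq | yes h≤k = subst Place (cong suc (trans (cong (d +_) (sym eq)) (m+[n∸m]≡n (≮⇒≥ i≮d)))) (peak h≤k)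
  place i | no i≮d | h , inj₂ eq | yes h≤k = subst Place (cong suc (trans (sym (+-suc d (2 * h))) (trans (cong (d +_) (sym eq)) (m+[n∸m]≡n (≮⇒≥ i≮d))))) (valley h≤k)
  place i | no i≮d | h , eq | no h≰k = high (s≤s (≤-trans (+-monoʳ-≤ d (≤-trans (*-monoʳ-≤ 2 (≰⇒> h≰k)) (2h≤ eq))) (≤-reflexive (m+[n∸m]≡n (≮⇒≥ i≮d)))))
    where
    2h≤ : ∀ {e} → e ≡ 2 * h ⊎ e ≡ suc (2 * h) → 2 * h ≤ e
    2h≤ (inj₁ eq) = ≤-reflexive (sym eq)
    2h≤ (inj₂ eq) = ≤-trans (n≤1+n _) (≤-reflexive (sym eq))

-- Counting along sequences

module _ {Q : Pred ℕ 0ℓ} (Q? : Decidable Q) where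

  count-≤-prefix : ∀ f m p → (∀ t → p ≤ t → t < m → ¬ Q (f t)) → count Q? (applyUpTo f m) ≤ p
  count-≤-prefix f zero p h = z≤n
  count-≤-prefix f (suc m) zero h rewrite filter-reject Q? {f 0} {applyUpTo (f ∘ suc) m} (h 0 z≤n z<s) =
    count-≤-prefix (f ∘ suc) m 0 (λ t _ t<m → h (suc t) z≤n (s≤s t<m))
  count-≤-prefix f (suc m) (suc p) h with Q? (f 0)
  ... | yes _ = s≤s (count-≤-prefix (f ∘ suc) m p (λ t p≤t t<m → h (suc t) (s≤s p≤t) (s≤s t<m)))
  ... | no _ = m≤n⇒m≤1+n (count-≤-prefix (f ∘ suc) m p (λ t p≤t t<m → h (suc t) (s≤s p≤t) (s≤s t<m)))

  count-≥-segment : ∀ f m s p → s + p ≤ m → (∀ t → s ≤ t → t < s + p → Q (f t)) → p ≤ count Q? (applyUpTo f m)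
  count-≥-segment f m zero zero _ _ = z≤n
  count-≥-segment f (suc m) zero (suc p) (s≤s le) h rewrite filter-accept Q? {f 0} {applyUpTo (f ∘ suc) m} (h 0 z≤n z<s) =
    s≤s (count-≥-segment (f ∘ suc) m 0 p le (λ t _ t<p → h (suc t) z≤n (s≤s t<p)))
  count-≥-segment f (suc m) (suc s) p (s≤s le) h =
    ≤-trans (count-≥-segment (f ∘ suc) m s p le (λ t s≤t t< → h (suc t) (s≤s s≤t) (s≤s t<))) (count-∷-≤ Q? (f 0) _)

  count-flat : ∀ a b m → count Q? (flat a b m) ≡ count Q? (applyUpTo a m) + count Q? (applyUpTo b m)
  count-flat a b zero = refl
  count-flat a b (suc m) = begin
    count Q? (a 0 ∷ b 0 ∷ flat a′ b′ m) ≡⟨ count-∷ Q? (a 0) _ ⟩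
    A + count Q? (b 0 ∷ flat a′ b′ m) ≡⟨ cong (A +_) (count-∷ Q? (b 0) _) ⟩
    A + (B + count Q? (flat a′ b′ m)) ≡⟨ cong (λ c → A + (B + c)) (count-flat a′ b′ m) ⟩
    A + (B + (count Q? (applyUpTo a′ m) + count Q? (applyUpTo b′ m))) ≡⟨ interchange A B _ _ ⟩
    (A + count Q? (applyUpTo a′ m)) + (B + count Q? (applyUpTo b′ m)) ≡⟨ cong₂ _+_ (count-∷ Q? (a 0) _) (count-∷ Q? (b 0) _) ⟨
    count Q? (applyUpTo a (suc m)) + count Q? (applyUpTo b (suc m)) ∎
    where
    open ≡-Reasoning
    a′ = a ∘ suc
    b′ = b ∘ suc
    A = count Q? [ a 0 ]
    B = count Q? [ b 0 ]
    interchange : ∀ w x y z → w + (x + (y + z)) ≡ (w + y) + (x + z)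
    interchange = solve-∀

-- Let `f i` be the first entry in a window of length `2 * x`. An entry more than `x` steps later is
-- at least `f i + 2 * x + 1` and lies outside, so at most `suc x` entries are inside.
spread⇒uncrowded : ∀ f m → (∀ i t → i + suc t < m → f i + 2 * suc t ≤ suc (f (i + suc t))) → ¬ Crowded (applyUpTo f m)
spread⇒uncrowded f m spread cr with crowded⇒window (applyUpTo f m) cr
... | p , x , _ , lt = <⇒≱ lt (bound f m spread)
  where
  bound : ∀ f m → (∀ i t → i + suc t < m → f i + 2 * suc t ≤ suc (f (i + suc t))) →
    count (in? p (p + 2 * x)) (applyUpTo f m) ≤ suc x
  bound f zero _ = z≤n
  bound f (suc m) spread with in? p (p + 2 * x) (f 0)
  ... | no ∉ rewrite filter-reject (in? p (p + 2 * x)) {f 0} {applyUpTo (f ∘ suc) m} ∉ = bound (f ∘ suc) m (λ i t lt → spread (suc i) t (s≤s lt))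
  ... | yes ∈@(p≤f₀ , _) rewrite filter-accept (in? p (p + 2 * x)) {f 0} {applyUpTo (f ∘ suc) m} ∈ =
    s≤s (count-≤-prefix (in? p (p + 2 * x)) (f ∘ suc) m x far)
    where
    open ≤-Reasoning
    far : ∀ t → x ≤ t → t < m → ¬ In p (p + 2 * x) (f (suc t))
    far t x≤t t<m (_ , f≤) = <-irrefl refl (begin-strict
      suc (p + 2 * x) <⟨ n<1+n _ ⟩
      2 + (p + 2 * x) ≡⟨ shuffle p x ⟩
      p + 2 * suc x ≤⟨ +-mono-≤ p≤f₀ (*-monoʳ-≤ 2 (s≤s x≤t)) ⟩
      f 0 + 2 * suc t ≤⟨ spread 0 t (s≤s t<m) ⟩
      suc (f (suc t)) ≤⟨ s≤s f≤ ⟩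
      suc (p + 2 * x) ∎)
      where
      shuffle : ∀ p x → 2 + (p + 2 * x) ≡ p + 2 * suc x
      shuffle = solve-∀

-- Bounds on the peaks and crowdedness

module Values {n} (d k r : ℕ) (a b : ℕ → ℕ) (perm : IsPerm n (blockWord d k r a b)) (il : Interlaced a b k) where

  W : List ℕ
  W = blockWord d k r a b

  top : ℕ
  top = d + 2 * suc k

  length-W : length W ≡ top + r
  length-W = length-blockWord d k r a b

  n≡ : n ≡ top + r
  n≡ = trans (sym (perm-length perm)) length-W

  flat-perm : flat a b (suc k) ↭ interval (suc d) (2 * suc k)
  flat-perm = ↭-cancelˡ tail (↭-trans (++-comm tail (flat a b (suc k)))
    (↭-trans (↭-cancelˡ (interval 1 d) (↭-trans (perm-interval perm) (↭-reflexive split)))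
      (++-comm (interval (suc d) (2 * suc k)) tail)))
    where
    tail = interval (suc top) r
    split : interval 1 n ≡ interval 1 d ++ interval (suc d) (2 * suc k) ++ tail
    split = trans (cong (interval 1) (trans n≡ (+-assoc d (2 * suc k) r)))
      (trans (interval-++ 1 d (2 * suc k + r)) (cong (interval 1 d ++_) (interval-++ (suc d) (2 * suc k) r)))

  range : ∀ {i} → i ≤ k → (d < a i × a i ≤ top) × (d < b i × b i ≤ top)
  range {i} i≤k = All-flat {In (suc d) top} a b (suc k) (All-resp-↭ (↭-sym flat-perm)
    (All.zip (interval-≥ (suc d) (2 * suc k) , All.map ≤-pred (interval-< (suc d) (2 * suc k))))) i (s≤s i≤k)

  -- By `rank`: the entries below `a i` are the `d` initial fixed points, the `i` earlier peaks and
  -- the valleys below `a i`.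
  peak-value : ∀ {i} → i ≤ k → a i ≡ suc (d + (i + count (_<? a i) (applyUpTo b (suc k))))
  peak-value {i} i≤k = begin
    a i ≡⟨ rank perm (∈-++⁺ʳ (interval 1 d) (∈-++⁺ˡ (a∈ a b (s≤s i≤k)))) ⟩
    suc (cnt W) ≡⟨ cong suc (count-++ (_<? a i) (interval 1 d) _) ⟩
    suc (cnt (interval 1 d) + cnt (flat a b (suc k) ++ interval (suc top) r)) ≡⟨ cong (λ c → suc (cnt (interval 1 d) + c)) (count-++ (_<? a i) (flat a b (suc k)) _) ⟩
    suc (cnt (interval 1 d) + (cnt (flat a b (suc k)) + cnt (interval (suc top) r))) ≡⟨ cong suc (cong₂ _+_
      (trans (count-all (_<? a i) (All.map (λ e<sd → <-≤-trans e<sd (proj₁ (proj₁ (range i≤k)))) (interval-< 1 d))) (length-interval 1 d))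
      (cong₂ _+_ (count-flat (_<? a i) a b (suc k)) (count-none (_<? a i) (All.map (λ top<e → ≤⇒≯ (≤-trans (proj₂ (proj₁ (range i≤k))) (<⇒≤ top<e))) (interval-≥ (suc top) r))))) ⟩
    suc (d + (cnt (applyUpTo a (suc k)) + cnt (applyUpTo b (suc k)) + 0)) ≡⟨ cong (λ c → suc (d + c)) (+-identityʳ _) ⟩
    suc (d + (cnt (applyUpTo a (suc k)) + cnt (applyUpTo b (suc k)))) ≡⟨ cong (λ c → suc (d + (c + cnt (applyUpTo b (suc k))))) a-count ⟩
    suc (d + (i + cnt (applyUpTo b (suc k)))) ∎
    where
    open ≡-Reasoning
    cnt = count (_<? a i)
    a∈ : ∀ a b {m i} → i < m → a i ∈ flat a b m
    a∈ a b {suc m} {zero} _ = here refl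
    a∈ a b {suc m} {suc i} (s≤s i<m) = there (there (a∈ (a ∘ suc) (b ∘ suc) i<m))
    a-count : cnt (applyUpTo a (suc k)) ≡ i
    a-count = ≤-antisym
      (count-≤-prefix (_<? a i) a (suc k) i λ t i≤t t≤k → ≤⇒≯ (a-mono il i≤t (≤-pred t≤k)))
      (count-≥-segment (_<? a i) a (suc k) 0 i (m≤n⇒m≤1+n i≤k) λ t _ t<i → a-strict il t<i i≤k)

  peak-≥ : ∀ {i j} → i ≤ k → j ≤ k → b j < a i → suc (d + (i + suc j)) ≤ a i
  peak-≥ {i} {j} i≤k j≤k bj<ai = ≤-trans (s≤s (+-monoʳ-≤ d (+-monoʳ-≤ i
    (count-≥-segment (_<? a i) b (suc k) 0 (suc j) (s≤s j≤k) λ t _ t≤j → ≤-<-trans (b-mono il (≤-pred t≤j) j≤k) bj<ai))))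
    (≤-reflexive (sym (peak-value i≤k)))

  -- The guard `j ≤ k` admits indices past the last valley. In particular `j` may be `suc k`, where
  -- the bound only says that there are `suc k` valleys.
  peak-≤ : ∀ {i j} → i ≤ k → (j ≤ k → ¬ (b j < a i)) → a i ≤ suc (d + (i + j))
  peak-≤ {i} {j} i≤k bj≮ai = ≤-trans (≤-reflexive (peak-value i≤k)) (s≤s (+-monoʳ-≤ d (+-monoʳ-≤ i
    (count-≤-prefix (_<? a i) b (suc k) j λ t j≤t t≤k bt<ai → bj≮ai (≤-trans j≤t (≤-pred t≤k)) (≤-<-trans (b-mono il j≤t (≤-pred t≤k)) bt<ai)))))

  -- The last valley below `a i` is then at most `b (2 + i)`. This bounds both the rank of `a i` and
  -- the span of an occurrence of 415263.
  NoLongInversion : Set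
  NoLongInversion = ∀ i → 3 + i ≤ k → ¬ (b (3 + i) < a i)

  peak-lower : ∀ {i} → i < k → d + 2 * i + 3 ≤ a i
  peak-lower {i} i<k = ≤-trans (≤-reflexive (eq d i)) (peak-≥ (<⇒≤ i<k) i<k (proj₁ (proj₂ (Interlaced.step il i i<k))))
    where
    eq : ∀ d i → d + 2 * i + 3 ≡ suc (d + (i + suc (suc i)))
    eq = solve-∀

  peak-lower′ : ∀ {i} → i ≤ k → d + 2 * i + 2 ≤ a i
  peak-lower′ {i} i≤k = ≤-trans (≤-reflexive (eq d i)) (peak-≥ i≤k i≤k (b<a il i i≤k))
    where
    eq : ∀ d i → d + 2 * i + 2 ≡ suc (d + (i + suc i))
    eq = solve-∀

  -- Here `a i` is at most d + 2i + 4, while a later peak with index j < k is at least d + 2j + 3;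
  -- these bounds are close enough for `spread⇒uncrowded`.
  noLong⇒uncrowded : NoLongInversion → ¬ Crowded (applyUpTo a k)
  noLong⇒uncrowded noLong = spread⇒uncrowded a k λ i t lt → begin
    a i + 2 * suc t ≤⟨ +-monoˡ-≤ (2 * suc t) (peak-≤ {j = 3 + i} (≤-trans (m≤m+n i (suc t)) (<⇒≤ lt)) (noLong i)) ⟩
    suc (d + (i + (3 + i))) + 2 * suc t ≡⟨ eq d i t ⟩
    suc (d + 2 * (i + suc t) + 3) ≤⟨ s≤s (peak-lower lt) ⟩
    suc (a (i + suc t)) ∎
    where
    open ≤-Reasoning
    eq : ∀ d i t → suc (d + (i + (3 + i))) + 2 * suc t ≡ suc (d + 2 * (i + suc t) + 3)
    eq = solve-∀

  -- A long inversion lifts `a i` to at least d + 2i + 5. The k - i peaks from a_i to a_{k-1} then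
  -- all lie between d + 2i + 5 and d + 2k + 1, a window of length 2x with x = k - i - 2 holding x +
  -- 2 entries.
  uncrowded⇒noLong : ¬ Crowded (applyUpTo a k) → NoLongInversion
  uncrowded⇒noLong ¬cr i 3+i≤k b<a = ¬cr (window⇒crowded (applyUpTo a k) p x (+-cancelʳ-≤ (2 + i) 1 x (≤-trans 3+i≤k (≤-reflexive (sym x+2+i)))) (count-≥-segment
    (in? p (p + 2 * x)) a k i (2 + x) (≤-reflexive i+2+x) λ t i≤t t< →
      ≤-trans (≤-trans (≤-reflexive (eq₁ d i)) (peak-≥ i≤k 3+i≤k b<a)) (a-mono il i≤t (<⇒≤ (t<k t<))) ,
      (begin
        a t ≤⟨ peak-≤ {j = suc k} (<⇒≤ (t<k t<)) (λ k<k → contradiction k<k (<-irrefl refl)) ⟩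
        suc (d + (t + suc k)) ≡⟨ eq₂ d t k ⟩
        d + suc t + suc k ≤⟨ +-monoˡ-≤ (suc k) (+-monoʳ-≤ d (t<k t<)) ⟩
        d + k + suc k ≡⟨ cong (λ k → d + k + suc k) x+2+i ⟨
        d + (x + (2 + i)) + suc (x + (2 + i)) ≡⟨ eq₃ d x i ⟩
        p + 2 * x ∎)))
    where
    open ≤-Reasoning
    p = d + 2 * i + 5
    x = k ∸ (2 + i)
    i≤k : i ≤ k
    i≤k = ≤-trans (m≤n+m i 3) 3+i≤k
    x+2+i : x + (2 + i) ≡ k
    x+2+i = m∸n+n≡m (≤-trans (n≤1+n _) 3+i≤k)
    eq₀ : ∀ i x → i + (2 + x) ≡ x + (2 + i)
    eq₀ = solve-∀
    i+2+x : i + (2 + x) ≡ k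
    i+2+x = trans (eq₀ i x) x+2+i
    t<k : ∀ {t} → t < i + (2 + x) → t < k
    t<k t< = <-≤-trans t< (≤-reflexive i+2+x)
    eq₁ : ∀ d i → d + 2 * i + 5 ≡ suc (d + (i + suc (3 + i)))
    eq₁ = solve-∀
    eq₂ : ∀ d t k → suc (d + (t + suc k)) ≡ d + suc t + suc k
    eq₂ = solve-∀
    eq₃ : ∀ d x i → d + (x + (2 + i)) + suc (x + (2 + i)) ≡ d + 2 * i + 5 + 2 * x
    eq₃ = solve-∀

  -- Without such an inversion every `a i` lies between d + 2i + 2 and d + 2i + 3, and peaks spread
  -- this evenly are not crowded.
  crowded⇒inversion : Crowded (applyUpTo a (suc k)) → ∃[ i ] (2 + i ≤ k × b (2 + i) < a i)
  crowded⇒inversion cr with anyUpTo? (λ i → (2 + i ≤? k) ×-dec (b (2 + i) <? a i)) (suc k)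
  ... | yes (i , _ , le , lt) = i , le , lt
  ... | no none = contradiction cr (spread⇒uncrowded a (suc k) λ i t lt → begin
    a i + 2 * suc t ≤⟨ +-monoˡ-≤ (2 * suc t) (peak-≤ {j = 2 + i} (i≤k i t lt) (λ le b<a → none (i , s≤s (i≤k i t lt) , le , b<a))) ⟩
    suc (d + (i + (2 + i))) + 2 * suc t ≡⟨ eq d i t ⟩
    suc (d + 2 * (i + suc t) + 2) ≤⟨ s≤s (peak-lower′ (≤-pred lt)) ⟩
    suc (a (i + suc t)) ∎)
    where
    open ≤-Reasoning
    i≤k : ∀ i t → i + suc t < suc k → i ≤ k
    i≤k i t lt = ≤-trans (m≤m+n i (suc t)) (≤-pred lt)
    eq : ∀ d i t → suc (d + (i + (2 + i))) + 2 * suc t ≡ suc (d + 2 * (i + suc t) + 2)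
    eq = solve-∀

-- A single-block permutation satisfies the characterization

-- The `m` gaps are each at least 1 and add up to at most `m`.
tight⇒consecutive : ∀ m (p : Fin (suc m) → ℕ) → (∀ x y → x Fin.< y → p x < p y) → p (fromℕ m) ≤ p zero + m → Consecutive p
tight⇒consecutive (suc m) p mono tight zero (suc zero) _ = ≤-antisym
  (+-cancelʳ-≤ m _ _ (≤-trans (spread m (p ∘ suc) (λ x y lt → mono (suc x) (suc y) (s≤s lt))) (≤-trans tight (≤-reflexive (+-suc (p zero) m)))))
  (mono zero (suc zero) z<s)
  where
  spread : ∀ m (p : Fin (suc m) → ℕ) → (∀ x y → x Fin.< y → p x < p y) → p zero + m ≤ p (fromℕ m)
  spread zero p mono = ≤-reflexive (+-identityʳ (p zero))
  spread (suc m) p mono = ≤-trans (≤-reflexive (+-suc (p zero) m)) (≤-trans (+-monoˡ-≤ m (mono zero (suc zero) z<s))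
    (spread m (p ∘ suc) (λ x y lt → mono (suc x) (suc y) (s≤s lt))))
tight⇒consecutive (suc m) p mono tight zero (suc (suc y)) ()
tight⇒consecutive (suc m) p mono tight (suc x) (suc y) eq = tight⇒consecutive m (p ∘ suc)
  (λ x y lt → mono (suc x) (suc y) (s≤s lt))
  (≤-trans tight (≤-trans (≤-reflexive (+-suc (p zero) m)) (+-monoˡ-≤ m (mono zero (suc zero) z<s)))) x y (suc-injective eq)

module Positions {n} (d k r : ℕ) (a b : ℕ → ℕ) (perm : IsPerm n (blockWord d k r a b)) (il : Interlaced a b k) where
  open Values d k r a b perm il

  valley-≤-top : ∀ {j} → j ≤ k → suc (suc d + 2 * j) ≤ top
  valley-≤-top {j} j≤k = ≤-trans (≤-reflexive (eq d j)) (+-monoʳ-≤ d (*-monoʳ-≤ 2 (s≤s j≤k)))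
    where
    eq : ∀ d j → suc (suc d + 2 * j) ≡ d + 2 * suc j
    eq = solve-∀

  top≤n : top ≤ length W
  top≤n = ≤-trans (m≤m+n top r) (≤-reflexive (sym length-W))

  half< : ∀ {i j} → d + 2 * i < d + 2 * j → i < j
  half< {i} {j} lt = *-cancelˡ-< 2 i j (+-cancelˡ-< d _ _ lt)

  -- Low, block and high positions carry increasing ranges of values. Within the block peaks
  -- increase, valleys increase, and a valley is below every later peak, so only a peak followed by
  -- a valley remains. Here `s` and `t` count positions from 0.
  inversion : ∀ {s t} → s < t → t < length W → at W (suc t) < at W (suc s) →
    ∃[ i ] ∃[ j ] (i ≤ k × j ≤ k × s ≡ d + 2 * i × t ≡ suc d + 2 * j × b j < a i)
  inversion {s} {t} s<t t<n lt with place d k r a b s | place d k r a b t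
  ... | low s<d | low t<d rewrite at-low d k r a b s<d | at-low d k r a b t<d = contradiction (≤-pred lt) (<-asym s<t)
  ... | low s<d | peak j≤k rewrite at-low d k r a b s<d | at-peak d k r a b j≤k = contradiction (≤-trans (<⇒≤ lt) s<d) (<⇒≱ (proj₁ (proj₁ (range j≤k))))
  ... | low s<d | valley j≤k rewrite at-low d k r a b s<d | at-valley d k r a b j≤k = contradiction (≤-trans (<⇒≤ lt) s<d) (<⇒≱ (proj₁ (proj₂ (range j≤k))))
  ... | low s<d | high top<t rewrite at-low d k r a b s<d | at-high d k r a b top<t (subst (suc t ≤_) length-W t<n) = contradiction (≤-pred lt) (<-asym s<t)
  ... | peak i≤k | low t<d = contradiction (<-trans s<t t<d) (≤⇒≯ (m≤m+n d _))
  ... | peak i≤k | peak j≤k rewrite at-peak d k r a b i≤k | at-peak d k r a b j≤k = contradiction lt (<-asym (a-strict il (half< s<t) j≤k))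
  ... | peak {i} i≤k | valley {j} j≤k rewrite at-peak d k r a b i≤k | at-valley d k r a b j≤k = i , j , i≤k , j≤k , refl , refl , lt
  ... | peak i≤k | high top<t rewrite at-peak d k r a b i≤k | at-high d k r a b top<t (subst (suc t ≤_) length-W t<n) =
    contradiction (<-trans top<t lt) (≤⇒≯ (proj₂ (proj₁ (range i≤k))))
  ... | valley i≤k | low t<d = contradiction (<-trans s<t t<d) (≤⇒≯ (≤-trans (m≤m+n d _) (n≤1+n _)))
  ... | valley i≤k | peak {j} j≤k rewrite at-valley d k r a b i≤k | at-peak d k r a b j≤k =
    contradiction lt (<-asym (<-trans (b-strict il (half< (<-trans (n<1+n _) s<t)) j≤k) (b<a il j j≤k)))
  ... | valley i≤k | valley j≤k rewrite at-valley d k r a b i≤k | at-valley d k r a b j≤k = contradiction lt (<-asym (b-strict il (half< (≤-pred s<t)) j≤k))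
  ... | valley i≤k | high top<t rewrite at-valley d k r a b i≤k | at-high d k r a b top<t (subst (suc t ≤_) length-W t<n) =
    contradiction (<-trans top<t lt) (≤⇒≯ (proj₂ (proj₂ (range i≤k))))
  ... | high top<s | low t<d = contradiction (<-trans s<t t<d) (≤⇒≯ (≤-trans (m≤m+n d _) (≤-pred top<s)))
  ... | high top<s | peak j≤k = contradiction (<-trans top<s (s≤s s<t)) (≤⇒≯ (≤-trans (n≤1+n _) (valley-≤-top j≤k)))
  ... | high top<s | valley j≤k = contradiction (<-trans top<s (s≤s s<t)) (≤⇒≯ (valley-≤-top j≤k))
  ... | high top<s | high top<t rewrite at-high d k r a b top<s (subst (suc s ≤_) length-W (<-trans s<t t<n))
    | at-high d k r a b top<t (subst (suc t ≤_) length-W t<n) = contradiction (≤-pred lt) (<-asym s<t)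

  at-peak-from : ∀ i t → t + i ≤ k → at W (suc d + 2 * i + 2 * t) ≡ a (t + i)
  at-peak-from i t le = trans (cong (at W) (eq d i t)) (at-peak d k r a b le)
    where
    eq : ∀ d i t → suc d + 2 * i + 2 * t ≡ suc d + 2 * (t + i)
    eq = solve-∀

  at-valley-from : ∀ i t → t + i ≤ k → at W (suc d + 2 * i + suc (2 * t)) ≡ b (t + i)
  at-valley-from i t le = trans (cong (at W) (eq d i t)) (at-valley d k r a b le)
    where
    eq : ∀ d i t → suc d + 2 * i + suc (2 * t) ≡ suc (suc d + 2 * (t + i))
    eq = solve-∀

  window-bounds : ∀ i → 2 + i ≤ k → ∀ (x : Fin 6) → 1 ≤ suc d + 2 * i + toℕ x × suc d + 2 * i + toℕ x ≤ length W
  window-bounds i le x = s≤s z≤n , ≤-trans (+-monoʳ-≤ (suc d + 2 * i) (toℕ≤pred[n] x)) (≤-trans (≤-reflexive (eq d i)) (≤-trans (+-monoʳ-≤ d (*-monoʳ-≤ 2 (s≤s le))) top≤n))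
    where
    eq : ∀ d i → suc d + 2 * i + 5 ≡ d + 2 * (3 + i)
    eq = solve-∀

  module _ (i : ℕ) (le : 2 + i ≤ k) where

    private
      le₁ : 1 + i ≤ k
      le₁ = ≤-trans (n≤1+n _) le
      le₀ : i ≤ k
      le₀ = ≤-trans (n≤1+n _) le₁
      b₀<b₁ = b-strict il {i} {1 + i} ≤-refl le₁
      b₁<b₂ = b-strict il {1 + i} {2 + i} ≤-refl le
      b₁<a₀ = proj₁ (proj₂ (Interlaced.step il i le₁))
      b₂<a₁ = proj₁ (proj₂ (Interlaced.step il (1 + i) le))
      a₀<a₁ = a-strict il {i} {1 + i} ≤-refl le₁
      a₁<a₂ = a-strict il {1 + i} {2 + i} ≤-refl le

    -- Interlacing orders the six letters of the window except for `b (2 + i)` against `a i`; the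
    -- two outcomes are the two patterns.
    occurs-415263 : b (2 + i) < a i → Occurrence p415263 W (λ j → suc d + 2 * i + toℕ j)
    occurs-415263 b₂<a₀ = pattern-occurrence p415263 W _ (b i ∷ b (1 + i) ∷ b (2 + i) ∷ a i ∷ a (1 + i) ∷ a (2 + i) ∷ [])
      (Linked⇒AllPairs <-trans (b₀<b₁ ∷ b₁<b₂ ∷ b₂<a₀ ∷ a₀<a₁ ∷ a₁<a₂ ∷ [-]))
      (λ where
        zero → 3 , refl , from-yes (3 <? 6) , at-peak-from i 0 le₀
        (suc zero) → 0 , refl , from-yes (0 <? 6) , at-valley-from i 0 le₀
        (suc (suc zero)) → 4 , refl , from-yes (4 <? 6) , at-peak-from i 1 le₁
        (suc (suc (suc zero))) → 1 , refl , from-yes (1 <? 6) , at-valley-from i 1 le₁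
        (suc (suc (suc (suc zero)))) → 5 , refl , from-yes (5 <? 6) , at-peak-from i 2 le
        (suc (suc (suc (suc (suc zero))))) → 2 , refl , from-yes (2 <? 6) , at-valley-from i 2 le)
      (window-bounds i le) (λ _ _ → +-monoʳ-< (suc d + 2 * i))

    occurs-315264 : a i < b (2 + i) → Occurrence p315264 W (λ j → suc d + 2 * i + toℕ j)
    occurs-315264 a₀<b₂ = pattern-occurrence p315264 W _ (b i ∷ b (1 + i) ∷ a i ∷ b (2 + i) ∷ a (1 + i) ∷ a (2 + i) ∷ [])
      (Linked⇒AllPairs <-trans (b₀<b₁ ∷ b₁<a₀ ∷ a₀<b₂ ∷ b₂<a₁ ∷ a₁<a₂ ∷ [-]))
      (λ where
        zero → 2 , refl , from-yes (2 <? 6) , at-peak-from i 0 le₀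
        (suc zero) → 0 , refl , from-yes (0 <? 6) , at-valley-from i 0 le₀
        (suc (suc zero)) → 4 , refl , from-yes (4 <? 6) , at-peak-from i 1 le₁
        (suc (suc (suc zero))) → 1 , refl , from-yes (1 <? 6) , at-valley-from i 1 le₁
        (suc (suc (suc (suc zero)))) → 5 , refl , from-yes (5 <? 6) , at-peak-from i 2 le
        (suc (suc (suc (suc (suc zero))))) → 3 , refl , from-yes (3 <? 6) , at-valley-from i 2 le)
      (window-bounds i le) (λ _ _ → +-monoʳ-< (suc d + 2 * i))

    a≢b₂ : a i ≢ b (2 + i)
    a≢b₂ eq = allPairs-at (perm-unique perm) {d + 2 * i} {suc d + 2 * (2 + i)}
      (s≤s (+-monoʳ-≤ d (*-monoʳ-≤ 2 (m≤n+m i 2)))) (≤-trans (valley-≤-top le) top≤n)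
      (trans (at-peak d k r a b le₀) (trans eq (sym (at-valley d k r a b le))))

  -- The end letters 4 and 3 of an occurrence form an inversion, hence sit at some a_i and b_j with
  -- j at most i + 2. This leaves just six positions for the six letters.
  consecutive-415263 : NoLongInversion → ∀ p → Occurrence p415263 W p → Consecutive p
  consecutive-415263 noLong p (bounds , mono , iff) = tight⇒consecutive 5 p mono
    (tight (proj₁ (bounds zero)) (mono zero (# 5) z<s) (proj₂ (bounds (# 5))) (Equivalence.to (iff (# 5) zero) (from-yes (3 <? 4))))
    where
    tight : ∀ {s t} → 1 ≤ s → s < t → t ≤ length W → at W t < at W s → t ≤ s + 5
    tight {suc s} {suc t} _ (s≤s s<t) t<n lt with inversion s<t t<n lt
    ... | i , j , _ , j≤k , refl , refl , bj<ai with 3 + i ≤? j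
    ...   | yes 3+i≤j = contradiction (≤-<-trans (b-mono il 3+i≤j j≤k) bj<ai) (noLong i (≤-trans 3+i≤j j≤k))
    ...   | no j< = ≤-trans (s≤s (s≤s (+-monoʳ-≤ d (*-monoʳ-≤ 2 (≤-pred (≰⇒> j<)))))) (≤-reflexive (eq d i))
      where
      eq : ∀ d i → suc (suc d + 2 * (2 + i)) ≡ suc d + 2 * i + 5
      eq = solve-∀

  characterization : Crowded (applyUpTo a (suc k)) → NoLongInversion → Characterization n W
  characterization cr noLong with crowded⇒inversion cr
  ... | i₀ , 2+i₀≤k , b₂<a₀ = suc d , k , ≤-trans (m≤m+n 2 i₀) 2+i₀≤k
    , (λ j → mk⇔ descent⇒peak peak⇒descent)
    , subst Crowded (sym (trans (map-upTo _ (suc k)) (applyUpTo-cong (suc k) (λ i i<sk → at-peak d k r a b (≤-pred i<sk))))) cr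
    , fixed
    , ((_ , occurs-415263 i₀ 2+i₀≤k b₂<a₀) , consecutive-415263 noLong)
    , windows
    where
    applyUpTo-cong : ∀ {f g : ℕ → ℕ} m → (∀ i → i < m → f i ≡ g i) → applyUpTo f m ≡ applyUpTo g m
    applyUpTo-cong zero h = refl
    applyUpTo-cong (suc m) h = cong₂ _∷_ (h 0 z<s) (applyUpTo-cong m (λ i i<m → h (suc i) (s≤s i<m)))
    descent⇒peak : ∀ {j} → IsDescent W j → ∃[ i ] (i ≤ k × j ≡ suc d + 2 * i)
    descent⇒peak {suc s} (_ , s<n , lt) with inversion {s} {suc s} ≤-refl s<n lt
    ... | i , _ , i≤k , _ , s≡ , _ = i , i≤k , cong suc s≡
    peak⇒descent : ∀ {j} → ∃[ i ] (i ≤ k × j ≡ suc d + 2 * i) → IsDescent W j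
    peak⇒descent (i , i≤k , refl) = s≤s z≤n , ≤-trans (valley-≤-top i≤k) top≤n ,
      subst₂ _<_ (sym (at-valley d k r a b i≤k)) (sym (at-peak d k r a b i≤k)) (b<a il i i≤k)
    fixed : ∀ i → 1 ≤ i → i ≤ n → (i < suc d ⊎ suc d + 2 * k + 1 < i) → at W i ≡ i
    fixed (suc i) _ _ (inj₁ (s≤s i<d)) = at-low d k r a b i<d
    fixed i _ i≤n (inj₂ lt) = at-high d k r a b (≤-<-trans (≤-reflexive (eq d k)) lt) (subst (i ≤_) n≡ i≤n)
      where
      eq : ∀ d k → d + 2 * suc k ≡ suc d + 2 * k + 1
      eq = solve-∀
    windows : ∀ i → i + 2 ≤ k → Occurrence p415263 W (λ j → suc d + 2 * i + toℕ j) ⊎ Occurrence p315264 W (λ j → suc d + 2 * i + toℕ j)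
    windows i i+2≤k with <-cmp (b (2 + i)) (a i)
    ... | tri< lt _ _ = inj₁ (occurs-415263 i (subst (_≤ k) (+-comm i 2) i+2≤k) lt)
    ... | tri≈ _ eq _ = contradiction (sym eq) (a≢b₂ i (subst (_≤ k) (+-comm i 2) i+2≤k))
    ... | tri> _ _ gt = inj₂ (occurs-315264 i (subst (_≤ k) (+-comm i 2) i+2≤k) gt)

-- The characterization implies minimality

bumped-sorted : ∀ {R} G → AllPairs _<_ G → R ≪ G → bumped R G ≡ []
bumped-sorted [] _ _ = refl
bumped-sorted (x ∷ G) (x<G ∷ sG) (R<x ∷ R≪G) = trans (bumped-append G (≪-≤ R<x)) (bumped-sorted G sG (≪-∷ʳ R≪G x<G))

bumped-prefix : ∀ R F {v} → R ≪ (F ++ v) → AllPairs _<_ F → F ≪ v → bumped R (F ++ v) ≡ bumped (R ++ F) v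
bumped-prefix R [] _ _ _ rewrite ++-identityʳ R = refl
bumped-prefix R (f ∷ F) {v} (R<f ∷ R≪) (f<F ∷ sF) F≪v = trans (bumped-append (F ++ v) (≪-≤ R<f))
  (trans (bumped-prefix (R ∷ʳ f) F (≪-∷ʳ R≪ (All.++⁺ f<F (All.map All.head F≪v))) sF (All.map All.tail F≪v))
    (cong (λ X → bumped X v) (∷ʳ-++ R f F)))

⋖-prefix : ∀ F {v X} → AllPairs _<_ F → F ≪ X → v ⋖ (F ++ X) → ∃[ v′ ] (v ≡ F ++ v′ × v′ ⋖ X)
⋖-prefix [] _ _ v⋖ = _ , refl , v⋖
⋖-prefix (f ∷ []) _ ((f<x ∷ _) ∷ _) (swap x<f) = contradiction x<f (<-asym f<x)
⋖-prefix (f ∷ x ∷ F) ((f<x ∷ _) ∷ _) _ (swap x<f) = contradiction x<f (<-asym f<x)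
⋖-prefix (f ∷ F) (_ ∷ sF) F≪X (skip v⋖) with ⋖-prefix F sF (All.map All.tail F≪X) v⋖
... | v′ , refl , v′⋖X = v′ , refl , v′⋖X

module _ {n} (d k r : ℕ) (a b : ℕ → ℕ) (perm : IsPerm n (blockWord d k r a b)) (il : Interlaced a b k) where
  open Values d k r a b perm il

  -- The initial fixed points settle in the row as `F` and bump nothing. All descents lie in the
  -- block, so undoing any of them leaves a_0, ..., a_{k-1} by `bumped-swapped`.
  blockWord-locallyMinimal : Crowded (applyUpTo a (suc k)) → NoLongInversion → LocallyMinimal W
  blockWord-locallyMinimal cr noLong =
    subst Crowded (sym (trans (prefix F≪X) (trans (bumped-flat G-bumped il a<G F≪X) (++-identityʳ _)))) cr , undo
    where
    F = interval 1 d
    G = interval (suc top) r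
    X = flat a b (suc k) ++ G
    a<G : All (a k <_) G
    a<G = All.map (≤-trans (s≤s (proj₂ (proj₁ (range ≤-refl))))) (interval-≥ (suc top) r)
    G-bumped : ∀ {R} → R ≪ G → bumped R G ≡ []
    G-bumped = bumped-sorted G (interval-sorted (suc top) r)
    F≪ : ∀ {x} → d < x → All (_< x) F
    F≪ d<x = All.map (λ e<sd → <-≤-trans e<sd d<x) (interval-< 1 d)
    F≪X : F ≪ X
    F≪X = All.++⁺
      (flat-All a b (suc k) (λ i i<sk → let (d<a , _) , (d<b , _) = range (≤-pred i<sk) in F≪ d<a , F≪ d<b))
      (All.map (λ top<x → F≪ (≤-<-trans (m≤m+n d _) top<x)) (interval-≥ (suc top) r))
    prefix : ∀ {v} → F ≪ v → bumped [] (F ++ v) ≡ bumped F v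
    prefix F≪v = bumped-prefix [] F (All.universal (λ _ → []) _) (interval-sorted 1 d) F≪v
    undo : ∀ v → v ⋖ W → ¬ Crowded (bumped [] v)
    undo v v⋖W with ⋖-prefix F (interval-sorted 1 d) F≪X v⋖W
    ... | v′ , refl , v′⋖X = noLong⇒uncrowded noLong ∘ subst Crowded
      (trans (prefix (⋖-All v′⋖X F≪X)) (trans (bumped-swapped G-bumped il a<G (interval-sorted (suc top) r) F≪X v′⋖X) (++-identityʳ _)))

-- Recovering the block from the characterization

module _ (w : List ℕ) (d k : ℕ) where

  private
    a b : ℕ → ℕ
    a i = at w (suc d + 2 * i)
    b i = at w (suc (suc d + 2 * i))

  module _ (windows : ∀ i → i + 2 ≤ k →
    Occurrence p415263 w (λ j → suc d + 2 * i + toℕ j) ⊎ Occurrence p315264 w (λ j → suc d + 2 * i + toℕ j)) where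

    module _ (i : ℕ) (le : 2 + i ≤ k) where

      private
        common : (x y : Fin 6) → lookup p415263 x < lookup p415263 y → lookup p315264 x < lookup p315264 y →
          at w (suc d + 2 * i + toℕ x) < at w (suc d + 2 * i + toℕ y)
        common x y lt₁ lt₂ with windows i (subst (_≤ k) (+-comm 2 i) le)
        ... | inj₁ (_ , _ , iff) = Equivalence.to (iff x y) lt₁
        ... | inj₂ (_ , _ , iff) = Equivalence.to (iff x y) lt₂
        peak≡ : ∀ t → at w (suc d + 2 * i + 2 * t) ≡ a (t + i)
        peak≡ t = cong (at w) (eq d i t)
          where
          eq : ∀ d i t → suc d + 2 * i + 2 * t ≡ suc d + 2 * (t + i)
          eq = solve-∀
        valley≡ : ∀ t → at w (suc d + 2 * i + suc (2 * t)) ≡ b (t + i)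
        valley≡ t = cong (at w) (eq d i t)
          where
          eq : ∀ d i t → suc d + 2 * i + suc (2 * t) ≡ suc (suc d + 2 * (t + i))
          eq = solve-∀

      window-first : b i < b (1 + i) × b (1 + i) < a i × a i < a (1 + i)
      window-first =
        subst₂ _<_ (valley≡ 0) (valley≡ 1) (common (# 1) (# 3) (from-yes (1 <? 2)) (from-yes (1 <? 2))) ,
        subst₂ _<_ (valley≡ 1) (peak≡ 0) (common (# 3) (# 0) (from-yes (2 <? 4)) (from-yes (2 <? 3))) ,
        subst₂ _<_ (peak≡ 0) (peak≡ 1) (common (# 0) (# 2) (from-yes (4 <? 5)) (from-yes (3 <? 5)))

      window-second : b (1 + i) < b (2 + i) × b (2 + i) < a (1 + i) × a (1 + i) < a (2 + i)
      window-second =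
        subst₂ _<_ (valley≡ 1) (valley≡ 2) (common (# 3) (# 5) (from-yes (2 <? 3)) (from-yes (2 <? 4))) ,
        subst₂ _<_ (valley≡ 2) (peak≡ 1) (common (# 5) (# 2) (from-yes (3 <? 5)) (from-yes (4 <? 5))) ,
        subst₂ _<_ (peak≡ 1) (peak≡ 2) (common (# 2) (# 4) (from-yes (5 <? 6)) (from-yes (5 <? 6)))

      window-last : b (2 + i) < a (2 + i)
      window-last = subst₂ _<_ (valley≡ 2) (peak≡ 2) (common (# 5) (# 4) (from-yes (3 <? 6)) (from-yes (4 <? 6)))

    -- Both patterns agree on every comparison needed. Window `i` yields the steps `i` and `suc i`;
    -- the last window thus also supplies the step k - 1, at which no window starts, and the
    -- comparison of `b k` with `a k`.
    windows⇒interlaced : 2 ≤ k → Interlaced a b k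
    windows⇒interlaced 2≤k = interlaced last step
      where
      last : b k < a k
      last = subst (λ k → b k < a k) (m+[n∸m]≡n 2≤k) (window-last (k ∸ 2) (≤-reflexive (m+[n∸m]≡n 2≤k)))
      step : ∀ i → i < k → b i < b (suc i) × b (suc i) < a i × a i < a (suc i)
      step i i<k with 2 + i ≤? k
      ... | yes le = window-first i le
      step zero i<k | no k<2 = contradiction 2≤k k<2
      step (suc i) i<k | no _ = window-second i i<k

  -- A long inversion would make a_i, b_i, a_{i+1}, b_{i+1}, a_{i+2}, b_{i+3} an occurrence of
  -- 415263 with a gap before its last letter.
  consecutive⇒noLong : Interlaced a b k → suc (suc d + 2 * k) ≤ length w → (∀ p → Occurrence p415263 w p → Consecutive p) →
    ∀ i → 3 + i ≤ k → ¬ (b (3 + i) < a i)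
  consecutive⇒noLong il top≤n consecutive i le b₃<a₀ =
    absurd (consecutive (lookup ps) (pattern-occurrence p415263 w (lookup ps)
      (b i ∷ b (1 + i) ∷ b (3 + i) ∷ a i ∷ a (1 + i) ∷ a (2 + i) ∷ [])
      (Linked⇒AllPairs <-trans (b-strict il ≤-refl le₁ ∷ b-strict il (n≤1+n _) le ∷ b₃<a₀ ∷ a-strict il ≤-refl le₁ ∷ a-strict il ≤-refl le₂ ∷ [-]))
      (λ where
        zero → 3 , refl , from-yes (3 <? 6) , refl
        (suc zero) → 0 , refl , from-yes (0 <? 6) , refl
        (suc (suc zero)) → 4 , refl , from-yes (4 <? 6) , refl
        (suc (suc (suc zero))) → 1 , refl , from-yes (1 <? 6) , refl
        (suc (suc (suc (suc zero)))) → 5 , refl , from-yes (5 <? 6) , refl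
        (suc (suc (suc (suc (suc zero))))) → 2 , refl , from-yes (2 <? 6) , refl)
      (λ where
        zero → peak-bounds le₀
        (suc zero) → valley-bounds le₀
        (suc (suc zero)) → peak-bounds le₁
        (suc (suc (suc zero))) → valley-bounds le₁
        (suc (suc (suc (suc zero)))) → peak-bounds le₂
        (suc (suc (suc (suc (suc zero))))) → valley-bounds le)
      (allPairs-lookup {_<_} {ps} (Linked⇒AllPairs <-trans
        (n<1+n _ ∷ next i ∷ n<1+n _ ∷ next (1 + i) ∷ <-trans (<-trans (n<1+n _) (next (2 + i))) (n<1+n _) ∷ [-]))))
      (# 4) (# 5) refl)
    where
    le₂ : 2 + i ≤ k
    le₂ = ≤-trans (n≤1+n _) le
    le₁ : 1 + i ≤ k
    le₁ = ≤-trans (n≤1+n _) le₂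
    le₀ : i ≤ k
    le₀ = ≤-trans (n≤1+n _) le₁
    pk = λ t → suc d + 2 * t
    ps = pk i ∷ suc (pk i) ∷ pk (1 + i) ∷ suc (pk (1 + i)) ∷ pk (2 + i) ∷ suc (pk (3 + i)) ∷ []
    absurd : suc (pk (3 + i)) ≡ suc (pk (2 + i)) → ⊥
    absurd eq = <-irrefl (*-cancelˡ-≡ (2 + i) (3 + i) 2 (+-cancelˡ-≡ d _ _ (suc-injective (suc-injective (sym eq))))) ≤-refl
    pk-suc : ∀ d t → suc (suc (suc d + 2 * t)) ≡ suc d + 2 * suc t
    pk-suc = solve-∀
    next : ∀ t → suc (pk t) < pk (suc t)
    next t = ≤-reflexive (pk-suc d t)
    valley-bounds : ∀ {t} → t ≤ k → 1 ≤ suc (pk t) × suc (pk t) ≤ length w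
    valley-bounds t≤k = s≤s z≤n , ≤-trans (s≤s (s≤s (+-monoʳ-≤ d (*-monoʳ-≤ 2 t≤k)))) top≤n
    peak-bounds : ∀ {t} → t ≤ k → 1 ≤ pk t × pk t ≤ length w
    peak-bounds t≤k = s≤s z≤n , ≤-trans (n≤1+n _) (proj₂ (valley-bounds t≤k))

-- Peaks and valleys are read off from `w` by position, and condition (c) gives the other entries,
-- so `w` agrees with a `blockWord` at every position.
characterization⇒locallyMinimal : ∀ {n w} → IsPerm n w → Characterization n w → LocallyMinimal w
-- Positions start at 1, so 0 cannot be a descent.
characterization⇒locallyMinimal perm (zero , _ , _ , descents , _) with Equivalence.from (descents 0) (0 , z≤n , refl)
... | () , _
characterization⇒locallyMinimal {n} {w} perm (suc d , k , 2≤k , descents , cr , fixed , (_ , consecutive) , windows) =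
  subst LocallyMinimal (sym word) (blockWord-locallyMinimal d k r a b (subst (IsPerm n) word perm) il
    (subst Crowded (map-upTo a (suc k)) cr) (consecutive⇒noLong w d k il top≤n consecutive))
  where
  a b : ℕ → ℕ
  a i = at w (suc d + 2 * i)
  b i = at w (suc (suc d + 2 * i))
  top = d + 2 * suc k
  r = n ∸ top
  il : Interlaced a b k
  il = windows⇒interlaced w d k windows 2≤k
  top≤n : suc (suc d + 2 * k) ≤ length w
  top≤n = proj₁ (proj₂ (Equivalence.from (descents (suc d + 2 * k)) (k , ≤-refl , refl)))
  top≡ : ∀ d k → d + 2 * suc k ≡ suc (suc d + 2 * k)
  top≡ = solve-∀
  top+r : top + r ≡ length w
  top+r = trans (m+[n∸m]≡n (≤-trans (≤-reflexive (top≡ d k)) (≤-trans top≤n (≤-reflexive (perm-length perm))))) (sym (perm-length perm))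
  same : ∀ i → i < length w → at w (suc i) ≡ at (blockWord d k r a b) (suc i)
  same i i<n with place d k r a b i
  ... | low i<d = trans (fixed (suc i) (s≤s z≤n) (subst (suc i ≤_) (perm-length perm) i<n) (inj₁ (s≤s i<d))) (sym (at-low d k r a b i<d))
  ... | peak j≤k = sym (at-peak d k r a b j≤k)
  ... | valley j≤k = sym (at-valley d k r a b j≤k)
  ... | high top<i = trans (fixed (suc i) (s≤s z≤n) (subst (suc i ≤_) (perm-length perm) i<n)
      (inj₂ (≤-<-trans (≤-reflexive (trans (+-comm _ 1) (sym (top≡ d k)))) top<i)))
    (sym (at-high d k r a b top<i (subst (suc i ≤_) (sym top+r) i<n)))
  word : w ≡ blockWord d k r a b
  word = at-ext w (blockWord d k r a b) (trans (sym top+r) (sym (length-blockWord d k r a b))) same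

locallyMinimal⇒characterization : ∀ {n w} → IsPerm n w → Avoids w → LocallyMinimal w → Characterization n w
locallyMinimal⇒characterization {n} {w} perm av (cr , below) = subst (Characterization n) (sym word)
  (Positions.characterization d k r a b perm′ interl crowded (Values.uncrowded⇒noLong d k r a b perm′ interl uncrowded))
  where
  []≪ : [] ≪ w
  []≪ = All.universal (λ _ → []) w
  sum : Sum w
  sum = rigid⇒sum (length w) [] w ≤-refl []≪ av (perm-unique perm) λ v v⋖w eq → below v v⋖w (subst Crowded (sym eq) cr)
  nf : Normal w
  nf = sum⇒normal sum []≪ (perm-unique perm) cr below
  open Normal nf hiding (word)
  d = length F
  r = length G
  word : w ≡ blockWord d k r a b
  word = normal⇒blockWord perm nf
  perm′ : IsPerm n (blockWord d k r a b)
  perm′ = subst (IsPerm n) word perm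

theorem5p15 : (n : ℕ) (w : List ℕ) → IsPerm n w → FullyCommutative w →
    (Minimal𝒞 n w ⇔ Characterization n w)
theorem5p15 n w perm fc = mk⇔
  (locallyMinimal⇒characterization perm av ∘ minimal⇒locallyMinimal perm av)
  (locallyMinimal⇒minimal perm av ∘ characterization⇒locallyMinimal perm)
  where
  av : Avoids w
  av = fullyCommutative⇒avoids (perm-unique perm) fc
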